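{- $$F_{231}(x,y)=\frac{1-2x+2xy-\sqrt{1-4x+4x^2-4x^2y}}{2xy},$$ that is, for all $r,n\ge 0$, $$F_{231;r}(x)=\frac{1}{r+1}\binom{2r}{r}\frac{x^{2r+1}}{(1-2x)^{2r+1}},\qquad f_{231;r}(n)=\frac{2^{n-2r-1}}{r+1}\binom{n-1}{2r}\binom{2r}{r}.$$
   Context: The pattern $231$ is written without dashes, so an occurrence of $231$ in $\pi=\pi_1\cdots\pi_n\in S_n$ is a position $i$ with $i+2\le n$ and $\pi_{i+2}<\pi_i<\pi_{i+1}$. A permutation is $1\text{ - }3\text{ - }2$-avoiding if there are no positions $a<b<c$ with $\pi_a<\pi_c<\pi_b$. $f_{\tau;r}(n)$ is the number of $1\text{ - }3\text{ - }2$-avoiding permutations in $S_n$ containing exactly $r$ occurrences of $\tau$ (with $S_0$ consisting of the empty permutation), $F_{\tau;r}(x)=\sum_{n\ge0}f_{\tau;r}(n)x^n$, and $F_\tau(x,y)=\sum_{r\ge 0} F_{\tau;r}(x)y^r$. The square root denotes the formal power series in $x$ with constant term $1$. The binomial coefficient $\binom ab$ is taken to be $0$ whenever $a<b$ or $b<0$.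
   Formalization: The displayed formulas fail at r = n = 0 (the empty permutation gives f(0) = 1, the formula gives 0); the formal theorem states f_{231;0}(0) = 1 and F_{231;0}(x) − 1 = x/(1−2x), and the formulas as printed for all other indices. -}

module Defs where

open import Algebra.Bundles using (RawRing)
import Algebra.Definitions.RawSemiring as RawSemiringDefinitions
open import Data.Fin.Base as Fin using (Fin; toℕ)
open import Data.Fin.Properties as Fin using (any?)
open import Data.Integer.Base using (ℤ; +_; -[1+_])
open import Data.List.Base using (List; []; _∷_; length; filter; allFin; cartesianProductWith)
open import Data.Nat.Base as ℕ using (ℕ; zero; suc; _∸_)
import Data.Nat.Properties as ℕ
open import Data.Nat.Combinatorics using (_C_)
open import Data.Product.Base using (_×_; ∃-syntax)
open import Data.Rational.Base as ℚ using (ℚ; ½)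
open import Data.Vec.Base as Vec using (Vec; lookup)
open import Data.Vec.Relation.Unary.AllPairs using (allPairs?)
open import Data.Vec.Relation.Unary.Unique.Propositional using (Unique)
open import Level using (Level; 0ℓ)
open import Relation.Binary.PropositionalEquality using (_≡_)
open import Relation.Nullary.Decidable using (Dec; _×-dec_; ¬?)
open import Relation.Nullary.Negation using (¬_)

private
  variable
    c ℓ : Level
    m n : ℕ

------------------------------------------------------------------------
-- Permutations

-- A word π₁⋯πₙ over {0,…,n−1}; the elements of Sₙ are the words with
-- pairwise distinct letters.  Positions and letters both count from 0.
Word : ℕ → Set
Word n = Vec (Fin n) n

Avoids132 : Word n → Set
Avoids132 {n} π =
  ¬ (∃[ a ] ∃[ b ] ∃[ c ] (a Fin.< b × b Fin.< c ×
       lookup π a Fin.< lookup π c × lookup π c Fin.< lookup π b))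

-- The letters at i, i+1, i+2 form 231; the existence of the position k
-- enforces that i+2 is still a position of π.
Occurs231At : Word n → Fin n → Set
Occurs231At π i =
  ∃[ j ] ∃[ k ] (toℕ j ≡ suc (toℕ i) × toℕ k ≡ suc (suc (toℕ i)) ×
    lookup π k Fin.< lookup π i × lookup π i Fin.< lookup π j)

unique? : (xs : Vec (Fin m) n) → Dec (Unique xs)
unique? = allPairs? (λ a b → ¬? (a Fin.≟ b))

avoids132? : (π : Word n) → Dec (Avoids132 π)
avoids132? π = ¬? (any? λ a → any? λ b → any? λ c →
  (a Fin.<? b) ×-dec (b Fin.<? c) ×-dec
  (lookup π a Fin.<? lookup π c) ×-dec (lookup π c Fin.<? lookup π b))

occurs231At? : (π : Word n) (i : Fin n) → Dec (Occurs231At π i)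
occurs231At? π i = any? λ j → any? λ k →
  (toℕ j ℕ.≟ suc (toℕ i)) ×-dec (toℕ k ℕ.≟ suc (suc (toℕ i))) ×-dec
  (lookup π k Fin.<? lookup π i) ×-dec (lookup π i Fin.<? lookup π j)

occ231 : Word n → ℕ
occ231 {n} π = length (filter (occurs231At? π) (allFin n))

-- Every vector of length n over Fin m, listed exactly once.
vectors : ∀ m n → List (Vec (Fin m) n)
vectors m zero    = Vec.[] ∷ []
vectors m (suc n) = cartesianProductWith Vec._∷_ (allFin m) (vectors m n)

permutations : ∀ n → List (Word n)
permutations n = filter unique? (vectors n n)

f231 : (r n : ℕ) → ℕ
f231 r n = length (filter (λ π → occ231 π ℕ.≟ r) (filter avoids132? (permutations n)))

------------------------------------------------------------------------
-- Formal power series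

-- The power series ring R[[t]]: f stands for Σₙ f(n) tⁿ.
powerSeries : RawRing c ℓ → RawRing c ℓ
powerSeries R = record
  { Carrier = ℕ → Carrier
  ; _≈_     = λ f g → ∀ n → f n ≈ g n
  ; _+_     = λ f g n → f n + g n
  ; _*_     = λ f g n → sum {suc n} (λ i → f (toℕ i) * g (n ∸ toℕ i))
  ; -_      = λ f n → - f n
  ; 0#      = λ _ → 0#
  ; 1#      = λ { zero → 1# ; (suc _) → 0# }
  }
  where
  open RawRing R
  open RawSemiringDefinitions rawSemiring using (sum)

module _ (R : RawRing c ℓ) where
  open RawRing R

  constant : Carrier → RawRing.Carrier (powerSeries R)
  constant a zero    = a
  constant a (suc _) = 0#

  variableₛ : RawRing.Carrier (powerSeries R)
  variableₛ 1 = 1#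
  variableₛ _ = 0#

-- Ring operations together with natural multiples k · a, powers a ^ k,
-- and subtraction.
module RingNotation (R : RawRing c ℓ) where
  open RawRing R public
  open RawSemiringDefinitions rawSemiring public
    using (_^_) renaming (_×_ to infixr 8 _·_)

  infixl 6 _-_
  _-_ : Carrier → Carrier → Carrier
  a - b = a + - b

  -- q is the quotient of a by b.  In an integral domain, with b ≠ 0, there
  -- is at most one such q; b need not be invertible (for instance b = 2xy).
  infix 4 _≈_÷_
  _≈_÷_ : Carrier → Carrier → Carrier → Set ℓ
  q ≈ a ÷ b = q * b ≈ a

ℚ[[x]] : RawRing 0ℓ 0ℓ
ℚ[[x]] = powerSeries ℚ.+-*-rawRing

-- ℚ[[x,y]] as ℚ[[x]][[y]]: the coefficient of xⁿyʳ in G is G r n.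
ℚ[[x,y]] : RawRing 0ℓ 0ℓ
ℚ[[x,y]] = powerSeries ℚ[[x]]

module Univariate where
  open RingNotation ℚ[[x]] public

  x : Carrier
  x = variableₛ ℚ.+-*-rawRing

  scalar : ℚ → Carrier
  scalar = constant ℚ.+-*-rawRing

module Bivariate where
  open RingNotation ℚ[[x,y]] public

  x y : Carrier
  x = constant ℚ[[x]] Univariate.x
  y = variableₛ ℚ[[x]]

  -- S = √D, the root whose constant term as a power series in x is 1
  -- (S r 0 is the coefficient of x⁰yʳ); S is determined by D.
  infix 4 _≈√_
  _≈√_ : Carrier → Carrier → Set
  S ≈√ D = S * S ≈ D × (∀ r → S r 0 ≡ 1# r 0)

------------------------------------------------------------------------
-- Generating functions

fromℕ : ℕ → ℚ
fromℕ k = + k ℚ./ 1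

F231[_] : ℕ → RawRing.Carrier ℚ[[x]]
F231[ r ] n = fromℕ (f231 r n)

-- Σᵣ F231[ r ] yʳ
F231 : RawRing.Carrier ℚ[[x,y]]
F231 r = F231[ r ]

------------------------------------------------------------------------
-- Numerical factors

-- The binomial coefficient, 0 whenever a < b or b < 0.  When a < 0 one of
-- the two always holds; _C_ is already 0 when 0 ≤ a < b.
binom : ℤ → ℤ → ℕ
binom (+ a)    (+ b)    = a C b
binom (+ _)    -[1+ _ ] = 0
binom -[1+ _ ] _        = 0

2^_ : ℤ → ℚ
2^ (+ k)    = fromℕ (2 ℕ.^ k)
2^ -[1+ k ] = RingNotation._^_ ℚ.+-*-rawRing ½ (suc k)

{-# OPTIONS --safe #-}
module Submission where

-- A 132-avoiding word of length n + 1 is σ n τ with every letter of σ above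
-- every letter of τ, and (σ , τ) ranges over all pairs of 132-avoiding words of
-- total length n.  Besides the occurrences of 231 inside σ and τ there is one more,
-- at the junction with n, exactly if σ and τ are both nonempty.  Hence G = F − 1
-- satisfies G = x (1 + 2G + yG²), whose discriminant gives the square root, and in
-- terms of the coefficients Gᵣ of yʳ
--     (1 − 2x) G₀ = x,   (1 − 2x) Gᵣ₊₁ = x Σᵢ Gᵢ Gᵣ₋ᵢ.
-- So Gᵣ (1 − 2x)²ʳ⁺¹ / x²ʳ⁺¹ obeys the Catalan recurrence.

-- The algebra avoids root extraction and nearly all division. The square root is not constructed:
-- `S` is written down as 1 - 2x(1 + yG), the negated derivative of the quadratic at its root G, so
-- its square is the discriminant by the equation for G alone, and its constant term 1 can be read
-- off. Quotients are stated as products, and a power of 1 - 2x is cancelled only where coefficients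
-- are extracted, with Σ 2ⁿxⁿ as the inverse of 1 - 2x. The Catalan step has an obstacle of its own:
-- the closed form with the central binomial coefficient directly yields only a first-order
-- recurrence, and the convolution has to be derived from that. Words become lists of naturals
-- because the two parts of a decomposition have smaller lengths and alphabets, and one of them is
-- shifted. The closed formulas describe G, not F: the empty permutation is the one word that they
-- miss.

open import Defs
open import Algebra.Bundles using (CommutativeRing; RawRing)
import Algebra.Properties.Semiring.Sum
open import Data.Empty using (⊥-elim)
open import Data.Fin.Base as Fin using (Fin; zero; suc; toℕ; fromℕ<)
import Data.Fin.Properties as Fin
open import Data.List.Base using (List; []; _∷_; _++_; map; length; filter;
  concat; tabulate; allFin; upTo; cartesianProduct)
open import Data.List.Membership.Propositional using (_∈_; _∉_)
open import Data.List.Membership.Propositional.Properties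
open import Data.List.Membership.Propositional.Properties.WithK using (unique∧set⇒bag)
open import Data.List.Properties using (∷-injective; length-++; length-map; length-upTo; map-injective)
open import Data.List.Relation.Binary.BagAndSetEquality using (∼bag⇒↭)
open import Data.List.Relation.Binary.Permutation.Propositional as ↭ using (_↭_)
open import Data.List.Relation.Binary.Subset.Propositional using (_⊆_)
open import Data.List.Relation.Unary.All as All using (All; []; _∷_)
import Data.List.Relation.Unary.All.Properties as All
open import Data.List.Relation.Unary.AllPairs as AllPairs using (AllPairs; []; _∷_)
import Data.List.Relation.Unary.AllPairs.Properties as AllPairs
open import Data.List.Relation.Unary.Any using (here; there)
open import Data.List.Relation.Unary.Unique.Propositional using (Unique)
import Data.List.Relation.Unary.Unique.Propositional.Properties as Unique
open import Data.Nat.Base as ℕ using (ℕ; zero; suc; _<_; _∸_; _!) renaming (_+_ to _+ℕ_; _*_ to _*ℕ_)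
import Data.Nat.Properties as ℕ
open import Data.Nat.Combinatorics using (_C_; nCk≡n!/k![n-k]!; k![n∸k]!∣n!; nCk+nC[k+1]≡[n+1]C[k+1];
  k>n⇒nCk≡0)
open import Data.Nat.DivMod using (m/n*n≡m)
open import Data.Nat.Induction using (<-rec)
open import Data.Nat.Tactic.RingSolver using (solve-∀)
open import Data.Product.Base using (_×_; _,_; proj₁; proj₂; ∃-syntax)
open import Data.Rational.Base as ℚ using (ℚ; 0ℚ; 1ℚ; _/_; fromℚᵘ) renaming (_*_ to _*ℚ_; _+_ to _+ℚ_)
import Data.Rational.Properties as ℚ
open import Data.Rational.Unnormalised.Base as ℚᵘ using (mkℚᵘ; *≡*)
import Data.Rational.Unnormalised.Properties as ℚᵘ
open import Data.Sum.Base using (inj₁; inj₂)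
open import Data.Vec.Base as Vec using (Vec; []; _∷_; lookup)
import Data.Vec.Properties as Vec
import Data.Vec.Relation.Unary.All as VecAll
import Data.Vec.Relation.Unary.AllPairs as VecAllPairs
import Data.Vec.Relation.Unary.Unique.Propositional as VecUnique
open import Function.Base using (_∘_; id)
open import Function.Bundles using (mk⇔)
open import Level using (Level)
open import Relation.Binary.Core using (Rel)
open import Relation.Binary.PropositionalEquality as ≡ using (_≡_; _≢_)
open import Relation.Nullary.Decidable using (Dec; yes; no; _×-dec_)
open import Relation.Nullary.Negation using (¬_)

-- Decomposition of 132-avoiding words at the largest letter

module Words where
  open import Data.Nat.Base
  open import Data.Nat.Properties
  open ≡ using (refl; sym; trans; cong; cong₂; subst; subst₂; module ≡-Reasoning)
  open import Data.List.Membership.DecPropositional _≟_ using (_∈?_)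

  private variable
    a ℓ : Level
    A : Set a
    n : ℕ
    xs ys : List A
    w σ τ : List ℕ

  -- Pigeonhole by deletion: cutting `x` out of `ys` keeps every other letter of `xs`, as these
  -- differ from `x`.
  unique⊆⇒length≤ : Unique xs → xs ⊆ ys → length xs ≤ length ys
  unique⊆⇒length≤ {xs = []} _ _ = z≤n
  unique⊆⇒length≤ {xs = x ∷ xs} (x≢xs ∷ xs!) sub with ∈-∃++ (sub (here refl))
  ... | as , bs , refl = begin
    suc (length xs)             ≤⟨ s≤s (unique⊆⇒length≤ xs! sub′) ⟩
    suc (length (as ++ bs))     ≡⟨ cong suc (length-++ as) ⟩
    suc (length as + length bs) ≡⟨ +-suc _ _ ⟨
    length as + suc (length bs) ≡⟨ length-++ as ⟨
    length (as ++ x ∷ bs)       ∎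
    where
    open ≤-Reasoning
    sub′ : xs ⊆ as ++ bs
    sub′ y∈xs with ∈-++⁻ as (sub (there y∈xs))
    ... | inj₁ y∈as         = ∈-++⁺ˡ y∈as
    ... | inj₂ (here y≡x)   = ⊥-elim (All.lookup x≢xs y∈xs (sym y≡x))
    ... | inj₂ (there y∈bs) = ∈-++⁺ʳ as y∈bs

  -- The only counting principle of the decomposition: it forces the largest letter to occur and
  -- fixes the alphabets of both parts.
  unique-bounded⇒length≤ : ∀ lo m → Unique w → All (λ x → lo ≤ x × x < lo + m) w → length w ≤ m
  unique-bounded⇒length≤ {w} lo m w! bounds = subst (length w ≤_)
    (trans (length-map (lo +_) (upTo m)) (length-upTo m))
    (unique⊆⇒length≤ w! λ x∈w → ∈-range (All.lookup bounds x∈w))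
    where
    ∈-range : ∀ {x} → lo ≤ x × x < lo + m → x ∈ map (lo +_) (upTo m)
    ∈-range {x} (lo≤x , x<lo+m) = subst (_∈ map (lo +_) (upTo m)) (m+[n∸m]≡n lo≤x)
      (∈-map⁺ (lo +_) (∈-upTo⁺ (+-cancelˡ-< lo _ _ (subst (_< lo + m) (sym (m+[n∸m]≡n lo≤x)) x<lo+m))))

  allPairs-++⁻ : ∀ {R : Rel A ℓ} xs {ys} → AllPairs R (xs ++ ys) →
                 AllPairs R xs × AllPairs R ys × All (λ x → All (R x) ys) xs
  allPairs-++⁻ []       Rys = [] , Rys , []
  allPairs-++⁻ (x ∷ xs) (Rx ∷ Rxsys) with allPairs-++⁻ xs Rxsys
  ... | Rxs , Rys , Rxy = (All.++⁻ˡ xs Rx ∷ Rxs) , Rys , (All.++⁻ʳ xs Rx ∷ Rxy)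

  -- Serves triples that fail to be 132 on account of their last letter, whatever the middle one is.
  allPairsʳ : ∀ {R : Rel A ℓ} {xs} → All (λ y → ∀ x → R x y) xs → AllPairs R xs
  allPairsʳ []         = []
  allPairsʳ (Ry ∷ Rys) = All.map (λ Rz → Rz _) Rys ∷ allPairsʳ Rys

  Not132 : ℕ → Rel ℕ _
  Not132 x y z = ¬ (x < z × z < y)

  -- Recursion on the first letter of a potential occurrence leaves a condition on pairs, so that
  -- appending and shifting are handled by `AllPairs`.
  data Avoids : List ℕ → Set where
    []  : Avoids []
    _∷_ : ∀ {x w} → AllPairs (Not132 x) w → Avoids w → Avoids (x ∷ w)

  record Avoider (n : ℕ) (w : List ℕ) : Set where
    constructor avoider
    field
      size    : length w ≡ n
      bounded : All (_< n) w
      unique  : Unique w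
      avoids  : Avoids w

  -- Of the triples across the cut, only those with `y` in the middle are kept: `y` will be the
  -- largest letter, and these force `xs` above `ys`.
  avoids-++⁻ : ∀ xs {y ys} → Avoids (xs ++ y ∷ ys) →
               Avoids xs × Avoids (y ∷ ys) × All (λ x → All (Not132 x y) ys) xs
  avoids-++⁻ []       av = [] , av , []
  avoids-++⁻ (x ∷ xs) (px ∷ av) with avoids-++⁻ xs av | allPairs-++⁻ xs px
  ... | avˡ , avʳ , cross | pxs , (py ∷ _) , _ = (pxs ∷ avˡ) , avʳ , (py ∷ cross)

  avoids-shift⁺ : ∀ c → Avoids w → Avoids (map (c +_) w)
  avoids-shift⁺ c []        = []
  avoids-shift⁺ c (px ∷ av) =
    AllPairs.map⁺ (AllPairs.map (λ p (lt₁ , lt₂) → p (+-cancelˡ-< c _ _ lt₁ , +-cancelˡ-< c _ _ lt₂)) px)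
    ∷ avoids-shift⁺ c av

  avoids-shift⁻ : ∀ c → Avoids (map (c +_) w) → Avoids w
  avoids-shift⁻ {[]}    c []        = []
  avoids-shift⁻ {_ ∷ _} c (px ∷ av) =
    AllPairs.map (λ p (lt₁ , lt₂) → p (+-monoʳ-< c lt₁ , +-monoʳ-< c lt₂)) (AllPairs.map⁻ px)
    ∷ avoids-shift⁻ c av

  unshift : ∀ c → All (c ≤_) w → ∃[ v ] w ≡ map (c +_) v
  unshift c []          = [] , refl
  unshift c (c≤x ∷ c≤w) with unshift c c≤w
  ... | v , refl = _ , cong (_∷ _) (sym (m+[n∸m]≡n c≤x))

  -- Gluing two words around a new largest letter, and the inverse decomposition

  Above : List ℕ → List ℕ → Set
  Above xs ys = All (λ x → All (_< x) ys) xs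

  avoids-∷-max : ∀ {m xs} → All (_< m) xs → Avoids xs → Avoids (m ∷ xs)
  avoids-∷-max xs<m av = allPairsʳ (All.map (λ c<m _ (m<c , _) → <-asym m<c c<m) xs<m) ∷ av

  -- A triple that starts in `xs` and ends in `ys` ends below its first letter; one that ends in `m`
  -- has a middle letter below `m`. Neither is 132.
  avoids-++⁺ : ∀ {xs m ys} → All (_< m) xs → Above xs ys →
               Avoids xs → Avoids (m ∷ ys) → Avoids (xs ++ m ∷ ys)
  avoids-++⁺ []         []            []         avʳ = avʳ
  avoids-++⁺ {x ∷ xs} {m} {ys} (_ ∷ xs<m) (ys<x ∷ above) (px ∷ avˡ) avʳ =
    AllPairs.++⁺ px (All.map (λ p → p m) low ∷ allPairsʳ low)
      (All.map (λ b<m → (λ (_ , m<b) → <-asym m<b b<m) ∷ All.map (λ p → p _) low) xs<m)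
    ∷ avoids-++⁺ xs<m above avˡ avʳ
    where
    low : All (λ c → ∀ b → Not132 x b c) ys
    low = All.map (λ c<x _ (x<c , _) → <-asym x<c c<x) ys<x

  -- An avoider `τ` uses exactly the letters below `length τ`, so the shift puts `σ` directly above
  -- them, and the sum of the lengths is the next free letter.
  glue : List ℕ × List ℕ → List ℕ
  glue (σ , τ) = map (length τ +_) σ ++ (length σ + length τ) ∷ τ

  below-max : ∀ {k l} → All (_< k) σ → All (_< k + l) (map (l +_) σ)
  below-max {k = k} {l} σ<k = All.map⁺ (All.map (λ {x} x<k → subst (l + x <_) (+-comm l k) (+-monoʳ-< l x<k)) σ<k)

  shift-above : ∀ {l} σ → All (_< l) τ → Above (map (l +_) σ) τ
  shift-above {l = l} σ τ<l = All.map⁺ (All.universal (λ x → All.map (λ c<l → <-≤-trans c<l (m≤m+n l x)) τ<l) σ)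

  glue-avoider : ∀ {k l} → Avoider k σ → Avoider l τ → Avoider (suc (k + l)) (glue (σ , τ))
  glue-avoider {σ = σ} {τ = τ} (avoider refl σ<k σ! σ-av) (avoider refl τ<l τ! τ-av) = record
    { size    = trans (length-++ (map (l +_) σ)) (trans (cong (_+ suc l) (length-map _ σ)) (+-suc k l))
    ; bounded = All.++⁺ (All.map m<n⇒m<1+n σ<m) (n<1+n _ ∷ All.map m<n⇒m<1+n τ<m)
    ; unique  = AllPairs.++⁺ (Unique.map⁺ (+-cancelˡ-≡ l _ _) σ!)
        (All.map (λ c<m m≡c → <-irrefl (sym m≡c) c<m) τ<m ∷ τ!)
        (All.zipWith (λ (x<m , τ<x) → (λ x≡m → <-irrefl x≡m x<m) ∷ All.map (λ c<x x≡c → <-irrefl (sym x≡c) c<x) τ<x)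
          (σ<m , shift-above σ τ<l))
    ; avoids  = avoids-++⁺ σ<m (shift-above σ τ<l) (avoids-shift⁺ l σ-av) (avoids-∷-max τ<m τ-av)
    }
    where
    k = length σ
    l = length τ
    σ<m = below-max {l = l} σ<k
    τ<m : All (_< k + l) τ
    τ<m = All.map (λ x<l → <-≤-trans x<l (m≤n+m l k)) τ<l

  -- Without `n`, the n + 1 distinct letters would all lie below n.
  max∈ : Avoider (suc n) w → n ∈ w
  max∈ {n} {w} (avoider size bounded w! _) with n ∈? w
  ... | yes n∈w = n∈w
  ... | no  n∉w = ⊥-elim (1+n≰n (subst (_≤ n) size (unique-bounded⇒length≤ 0 n w! (All.tabulate λ x∈w →
    z≤n , ≤∧≢⇒< (s≤s⁻¹ (All.lookup bounded x∈w)) λ { refl → n∉w x∈w }))))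

  -- ls lies above rs, since ls ∋ a < c ∈ rs would give the occurrence a n c.
  -- Counting distinct letters then shows that rs consists of letters below
  -- length rs, and that each letter of ls is at least length rs.
  avoider-split : Avoider (suc n) w → ∃[ σ ] ∃[ τ ] Avoider (length σ) σ × Avoider (length τ) τ
                  × length σ + length τ ≡ n × w ≡ glue (σ , τ)
  avoider-split {n} {w} av with ∈-∃++ (max∈ av)
  avoider-split {n} (avoider size bounded w! w-av) | ls , rs , refl
    with allPairs-++⁻ ls w! | avoids-++⁻ ls w-av
  ... | ls! , (n≢rs ∷ rs!) , ls≢ | avˡ , (_ ∷ avʳ) , cross =
    split (unshift (length rs) (All.map rs≤ above))
    where
    lengths : length ls + length rs ≡ n
    lengths = suc-injective (trans (sym (+-suc _ _)) (trans (sym (length-++ ls)) size))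

    <n : ∀ {x} → x < suc n → x ≢ n → x < n
    <n x<1+n = ≤∧≢⇒< (s≤s⁻¹ x<1+n)

    ls<n : All (_< n) ls
    ls<n = All.zipWith (λ { (x<1+n , x≢n ∷ _) → <n x<1+n x≢n }) (All.++⁻ˡ ls bounded , ls≢)

    rs<n : All (_< n) rs
    rs<n with _ ∷ rs<1+n ← All.++⁻ʳ ls bounded =
      All.zipWith (λ (x<1+n , n≢x) → <n x<1+n (n≢x ∘ sym)) (rs<1+n , n≢rs)

    above : Above ls rs
    above = All.zipWith (λ { (_ ∷ a≢rs , p) →
      All.zipWith (λ ((a≢c , ¬p) , c<n) → ≤∧≢⇒< (≮⇒≥ λ a<c → ¬p (a<c , c<n)) (a≢c ∘ sym))
        (All.zip (a≢rs , p) , rs<n) }) (ls≢ , cross)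

    rs≤ : ∀ {a} → All (_< a) rs → length rs ≤ a
    rs≤ rs<a = unique-bounded⇒length≤ 0 _ rs! (All.map (z≤n ,_) rs<a)

    rs<l : All (_< length rs) rs
    rs<l = All.tabulate λ {c} c∈rs →
      let c<n = All.lookup rs<n c∈rs
          eq = m+[n∸m]≡n c<n
          -- The letters of `ls` lie strictly between `c` and `n`, so there are at most n - 1 - c of
          -- them; comparison with |ls| + |rs| = n gives c < |rs|.
          k≤ = unique-bounded⇒length≤ (suc c) (n ∸ suc c) ls!
                 (All.zipWith (λ (a<n , rs<a) → All.lookup rs<a c∈rs , subst (_ <_) (sym eq) a<n) (ls<n , above))
      in +-cancelˡ-≤ (length ls) _ _ (subst₂ _≤_ (+-comm (suc c) _) (trans eq (sym lengths)) (+-monoʳ-≤ (suc c) k≤))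

    split : ∃[ σ ] ls ≡ map (length rs +_) σ → ∃[ σ ] ∃[ τ ] Avoider (length σ) σ × Avoider (length τ) τ
            × length σ + length τ ≡ n × ls ++ n ∷ rs ≡ glue (σ , τ)
    split (σ , refl) = σ , rs
      , avoider refl
          (All.map (λ {x} lx<n → +-cancelˡ-< l _ _ (subst (l + x <_) (trans (sym σ+l≡n) (+-comm _ l)) lx<n))
            (All.map⁻ ls<n))
          (Unique.map⁻ ls!) (avoids-shift⁻ l avˡ)
      , avoider refl rs<l rs! avʳ
      , σ+l≡n , cong (λ m → map (l +_) σ ++ m ∷ rs) (sym σ+l≡n)
      where
      l = length rs
      σ+l≡n : length σ + l ≡ n
      σ+l≡n = trans (cong (_+ l) (sym (length-map (l +_) σ))) lengths

  ++-∷-injective : ∀ {m : A} {ls rs ls′ rs′} → m ∉ ls → m ∉ ls′ →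
    ls ++ m ∷ rs ≡ ls′ ++ m ∷ rs′ → ls ≡ ls′ × rs ≡ rs′
  ++-∷-injective {ls = []}    {ls′ = []}    _ _  refl = refl , refl
  ++-∷-injective {ls = []}    {ls′ = _ ∷ _} _ ∉′ refl = ⊥-elim (∉′ (here refl))
  ++-∷-injective {ls = _ ∷ _} {ls′ = []}    ∉ _  refl = ⊥-elim (∉ (here refl))
  ++-∷-injective {ls = _ ∷ _} {ls′ = _ ∷ _} ∉ ∉′ eq with ∷-injective eq
  ... | refl , eq′ with ++-∷-injective (∉ ∘ there) (∉′ ∘ there) eq′
  ... | refl , refl = refl , refl

  -- Equal total lengths give both words the same largest letter, which marks the cut. Then τ = τ′,
  -- so both shifts agree and can be undone.
  glue-injective : ∀ {σ τ σ′ τ′} → All (_< length σ) σ → All (_< length σ′) σ′ →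
    length σ + length τ ≡ length σ′ + length τ′ → glue (σ , τ) ≡ glue (σ′ , τ′) → (σ , τ) ≡ (σ′ , τ′)
  glue-injective {σ} {τ} {σ′} {τ′} σ< σ′< lens eq
    with ++-∷-injective (max∉ {τ = τ} σ< refl) (max∉ {τ = τ′} σ′< lens)
           (trans eq (cong (λ m → map (length τ′ +_) σ′ ++ m ∷ τ′) (sym lens)))
    where
    max∉ : ∀ {σ τ : List ℕ} {m} → All (_< length σ) σ → m ≡ length σ + length τ → m ∉ map (length τ +_) σ
    max∉ {σ} σ< refl m∈ = <-irrefl refl (All.lookup (below-max σ<) m∈)
  ... | σ≡ , refl = cong (_, τ) (map-injective (+-cancelˡ-≡ (length τ) _ _) σ≡)

  -- Occurrences of 231 in a glued word

  indicator : ∀ {p} {P : Set p} → Dec P → ℕ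
  indicator (yes _) = 1
  indicator (no  _) = 0

  occ : List ℕ → ℕ
  occ (a ∷ b ∷ c ∷ w) = indicator ((c <? a) ×-dec (a <? b)) + occ (b ∷ c ∷ w)
  occ _               = 0

  indicator-cong : ∀ {p q} {P : Set p} {Q : Set q} (P? : Dec P) (Q? : Dec Q) →
                   (P → Q) → (Q → P) → indicator P? ≡ indicator Q?
  indicator-cong (yes p) (yes q) _ _ = refl
  indicator-cong (yes p) (no ¬q) f _ = ⊥-elim (¬q (f p))
  indicator-cong (no ¬p) (yes q) _ g = ⊥-elim (¬p (g q))
  indicator-cong (no ¬p) (no ¬q) _ _ = refl

  indicator-yes : ∀ {p} {P : Set p} (P? : Dec P) → P → indicator P? ≡ 1
  indicator-yes (yes _) p = refl
  indicator-yes (no ¬p) p = ⊥-elim (¬p p)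

  indicator-no : ∀ {p} {P : Set p} (P? : Dec P) → ¬ P → indicator P? ≡ 0
  indicator-no (yes p) ¬p = ⊥-elim (¬p p)
  indicator-no (no _)  ¬p = refl

  bothNonempty : List ℕ → List ℕ → ℕ
  bothNonempty (_ ∷ _) (_ ∷ _) = 1
  bothNonempty _       _       = 0

  bothNonempty-shift : ∀ {c} xs ys → bothNonempty (map (c +_) xs) ys ≡ bothNonempty xs ys
  bothNonempty-shift []      _       = refl
  bothNonempty-shift (_ ∷ _) []      = refl
  bothNonempty-shift (_ ∷ _) (_ ∷ _) = refl

  occ-shift : ∀ c w → occ (map (c +_) w) ≡ occ w
  occ-shift c []                = refl
  occ-shift c (_ ∷ [])          = refl
  occ-shift c (_ ∷ _ ∷ [])      = refl
  occ-shift c (x ∷ y ∷ z ∷ w) = cong₂ _+_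
    (indicator-cong _ _ (λ (p , q) → +-cancelˡ-< c _ _ p , +-cancelˡ-< c _ _ q)
      (λ (p , q) → +-monoʳ-< c p , +-monoʳ-< c q))
    (occ-shift c (y ∷ z ∷ w))

  occ-∷-max : ∀ {m xs} → All (_< m) xs → occ (m ∷ xs) ≡ occ xs
  occ-∷-max {xs = []}        _ = refl
  occ-∷-max {xs = _ ∷ []}    _ = refl
  occ-∷-max {m} {b ∷ c ∷ xs} (b<m ∷ _) = cong (_+ occ (b ∷ c ∷ xs))
    (indicator-no ((c <? m) ×-dec (m <? b)) λ (_ , m<b) → <-asym m<b b<m)

  -- As `m` exceeds all other letters, a window containing it can be 231 only with `m` in the
  -- middle; there it always is, since `ys` lies below `xs`. The cases on `xs` follow the
  -- three-letter lookahead of `occ`.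
  occ-++-max : ∀ {xs m ys} → All (_< m) xs → All (_< m) ys → Above xs ys →
               occ (xs ++ m ∷ ys) ≡ bothNonempty xs ys + (occ xs + occ ys)
  occ-++-max {[]} _ ys<m _ = occ-∷-max ys<m
  occ-++-max {_ ∷ []} {ys = []} _ _ _ = refl
  occ-++-max {_ ∷ []} {ys = _ ∷ _} (x<m ∷ _) ys<m ((y<x ∷ _) ∷ _) =
    cong₂ _+_ (indicator-yes _ (y<x , x<m)) (occ-∷-max ys<m)
  occ-++-max {x ∷ x′ ∷ []} {ys = ys} (x<m ∷ xs<m) ys<m (_ ∷ above) = trans
    (cong₂ _+_ (indicator-no _ λ (m<x , _) → <-asym m<x x<m) (occ-++-max xs<m ys<m above))
    (lemma ys)
    where
    lemma : ∀ ys → bothNonempty (x′ ∷ []) ys + occ ys ≡ bothNonempty (x ∷ x′ ∷ []) ys + occ ys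
    lemma []      = refl
    lemma (_ ∷ _) = refl
  occ-++-max {x ∷ x′ ∷ x″ ∷ xs} {ys = ys} (x<m ∷ xs<m) ys<m (_ ∷ above) = trans
    (cong (i +_) (occ-++-max xs<m ys<m above)) (lemma ys)
    where
    i = indicator ((x″ <? x) ×-dec (x <? x′))
    o = occ (x′ ∷ x″ ∷ xs)
    lemma : ∀ ys → i + (bothNonempty (x′ ∷ x″ ∷ xs) ys + (o + occ ys)) ≡
            bothNonempty (x ∷ x′ ∷ x″ ∷ xs) ys + (i + o + occ ys)
    lemma []       = sym (+-assoc i o _)
    lemma (y ∷ ys) = trans (+-suc i _) (cong suc (sym (+-assoc i o _)))

  occ-glue : ∀ {k l} → Avoider k σ → Avoider l τ → occ (glue (σ , τ)) ≡ bothNonempty σ τ + (occ σ + occ τ)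
  occ-glue {σ = σ} {τ = τ} (avoider refl σ<k _ _) (avoider refl τ<l _ _) = trans
    (occ-++-max (below-max σ<k) (All.map (λ x<l → <-≤-trans x<l (m≤n+m (length τ) (length σ))) τ<l) (shift-above σ τ<l))
    (cong₂ _+_ (bothNonempty-shift σ τ) (cong (_+ occ τ) (occ-shift _ σ)))

-- Words as lists of naturals

module Enumeration where
  open import Data.Nat.Base
  open import Data.Nat.Properties
  open ≡ using (refl; sym; trans; cong; cong₂; subst; subst₂; module ≡-Reasoning)
  open Words

  private variable
    a p ℓ : Level
    A B : Set a
    m n : ℕ
    P : ℕ → Set p

  toWord : Vec (Fin m) n → List ℕ
  toWord []      = []
  toWord (x ∷ v) = toℕ x ∷ toWord v

  all-toWord⁺ : ∀ (v : Vec (Fin m) n) → (∀ i → P (toℕ (lookup v i))) → All P (toWord v)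
  all-toWord⁺ []      p = []
  all-toWord⁺ (x ∷ v) p = p zero ∷ all-toWord⁺ v (p ∘ suc)

  all-toWord⁻ : ∀ (v : Vec (Fin m) n) → All P (toWord v) → ∀ i → P (toℕ (lookup v i))
  all-toWord⁻ (x ∷ v) (px ∷ _) zero    = px
  all-toWord⁻ (x ∷ v) (_ ∷ pv) (suc i) = all-toWord⁻ v pv i

  allPairs-toWord⁺ : ∀ {R : Rel ℕ ℓ} (v : Vec (Fin m) n) →
    (∀ {i j} → i Fin.< j → R (toℕ (lookup v i)) (toℕ (lookup v j))) → AllPairs R (toWord v)
  allPairs-toWord⁺ []      r = []
  allPairs-toWord⁺ (x ∷ v) r = all-toWord⁺ v (λ i → r {zero} {suc i} z<s) ∷ allPairs-toWord⁺ v (r ∘ s<s)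

  allPairs-toWord⁻ : ∀ {R : Rel ℕ ℓ} (v : Vec (Fin m) n) → AllPairs R (toWord v) →
    ∀ {i j} → i Fin.< j → R (toℕ (lookup v i)) (toℕ (lookup v j))
  allPairs-toWord⁻ (x ∷ v) (rx ∷ _) {zero}  {suc j} _   = all-toWord⁻ v rx j
  allPairs-toWord⁻ (x ∷ v) (_ ∷ rv) {suc i} {suc j} i<j = allPairs-toWord⁻ v rv (s<s⁻¹ i<j)

  unique-toWord⁺ : ∀ {v : Vec (Fin m) n} → VecUnique.Unique v → Unique (toWord v)
  unique-toWord⁺ VecAllPairs.[] = []
  unique-toWord⁺ {v = _ ∷ v} (x≢v VecAllPairs.∷ v!) = go x≢v ∷ unique-toWord⁺ v!
    where
    go : ∀ {n x} {v : Vec (Fin m) n} → VecAll.All (λ y → ¬ x ≡ y) v → All (λ y → ¬ toℕ x ≡ y) (toWord v)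
    go VecAll.[]       = []
    go (p VecAll.∷ ps) = (p ∘ Fin.toℕ-injective) ∷ go ps

  unique-toWord⁻ : ∀ (v : Vec (Fin m) n) → Unique (toWord v) → VecUnique.Unique v
  unique-toWord⁻ []      []        = VecAllPairs.[]
  unique-toWord⁻ (_ ∷ v) (x≢v ∷ v!) = go v x≢v VecAllPairs.∷ unique-toWord⁻ v v!
    where
    go : ∀ {n x} (v : Vec (Fin m) n) → All (λ y → ¬ toℕ x ≡ y) (toWord v) → VecAll.All (λ y → ¬ x ≡ y) v
    go []      []       = VecAll.[]
    go (_ ∷ v) (p ∷ ps) = (p ∘ cong toℕ) VecAll.∷ go v ps

  -- Length and alphabet are decoupled for induction: the tail of a word loses a position but keeps
  -- its alphabet. At m = n this is what `Avoids132` negates.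
  Contains132 : Vec (Fin m) n → Set
  Contains132 v =
    ∃[ a ] ∃[ b ] ∃[ c ] (a Fin.< b × b Fin.< c ×
      lookup v a Fin.< lookup v c × lookup v c Fin.< lookup v b)

  avoids-toWord⁺ : ∀ (v : Vec (Fin m) n) → ¬ Contains132 v → Avoids (toWord v)
  avoids-toWord⁺ []      _  = []
  avoids-toWord⁺ (x ∷ v) av =
    allPairs-toWord⁺ v (λ {b} {c} b<c (p , q) → av (zero , suc b , suc c , z<s , s<s b<c , p , q))
    ∷ avoids-toWord⁺ v λ (a , b , c , a<b , b<c , pq) → av (suc a , suc b , suc c , s<s a<b , s<s b<c , pq)

  avoids-toWord⁻ : ∀ (v : Vec (Fin m) n) → Avoids (toWord v) → ¬ Contains132 v
  avoids-toWord⁻ (x ∷ v) (px ∷ _) (zero , suc b , suc c , _ , b<c , pq) = allPairs-toWord⁻ v px (s<s⁻¹ b<c) pq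
  avoids-toWord⁻ (x ∷ v) (_ ∷ pv) (suc a , suc b , suc c , a<b , b<c , pq) =
    avoids-toWord⁻ v pv (a , b , c , s<s⁻¹ a<b , s<s⁻¹ b<c , pq)
  avoids-toWord⁻ (x ∷ v) _ (_ , zero , _ , () , _)
  avoids-toWord⁻ (x ∷ v) _ (_ , suc _ , zero , _ , () , _)

  length-toWord : ∀ (v : Vec (Fin m) n) → length (toWord v) ≡ n
  length-toWord []      = refl
  length-toWord (x ∷ v) = cong suc (length-toWord v)

  bounded-toWord : ∀ (v : Vec (Fin m) n) → All (_< m) (toWord v)
  bounded-toWord v = all-toWord⁺ v λ i → Fin.toℕ<n (lookup v i)

  toWord-injective : ∀ {u v : Vec (Fin m) n} → toWord u ≡ toWord v → u ≡ v
  toWord-injective {u = []}    {[]}    _  = refl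
  toWord-injective {u = _ ∷ _} {_ ∷ _} eq with ∷-injective eq
  ... | x≡y , u≡v = cong₂ _∷_ (Fin.toℕ-injective x≡y) (toWord-injective u≡v)

  toWord-surjective : ∀ {w} → length w ≡ n → All (_< m) w → ∃[ v ] w ≡ toWord {m} {n} v
  toWord-surjective refl []          = [] , refl
  toWord-surjective refl (x<m ∷ w<m) with toWord-surjective refl w<m
  ... | v , eq = fromℕ< x<m ∷ v , cong₂ _∷_ (sym (Fin.toℕ-fromℕ< x<m)) eq

  OccursAt : Vec (Fin m) n → Fin n → Set
  OccursAt v i = ∃[ j ] ∃[ k ] (toℕ j ≡ suc (toℕ i) × toℕ k ≡ suc (suc (toℕ i)) ×
      lookup v k Fin.< lookup v i × lookup v i Fin.< lookup v j)

  count : ∀ {Q : A → Set p} → (∀ x → Dec (Q x)) → List A → ℕ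
  count Q? xs = length (filter Q? xs)

  count-∷ : ∀ {Q : A → Set p} (Q? : ∀ x → Dec (Q x)) x xs → count Q? (x ∷ xs) ≡ indicator (Q? x) + count Q? xs
  count-∷ Q? x xs with Q? x
  ... | yes _ = refl
  ... | no  _ = refl

  count-tabulate : ∀ {Q : A → Set p} {Q′ : B → Set ℓ} (Q? : ∀ x → Dec (Q x)) (Q′? : ∀ x → Dec (Q′ x))
    (f : Fin n → A) (g : Fin n → B) → (∀ i → Q (f i) → Q′ (g i)) → (∀ i → Q′ (g i) → Q (f i)) →
    count Q? (tabulate f) ≡ count Q′? (tabulate g)
  count-tabulate {n = zero}  _  _   _ _ _ _ = refl
  count-tabulate {n = suc n} Q? Q′? f g to from = begin
    count Q? (tabulate f) ≡⟨ count-∷ Q? (f zero) _ ⟩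
    indicator (Q? (f zero)) + count Q? (tabulate (f ∘ suc))
      ≡⟨ cong₂ _+_ (indicator-cong _ _ (to zero) (from zero))
           (count-tabulate Q? Q′? (f ∘ suc) (g ∘ suc) (to ∘ suc) (from ∘ suc)) ⟩
    indicator (Q′? (g zero)) + count Q′? (tabulate (g ∘ suc)) ≡⟨ count-∷ Q′? (g zero) _ ⟨
    count Q′? (tabulate g) ∎
    where open ≡-Reasoning

  occursAt-suc : ∀ {x} {v : Vec (Fin m) n} {i} → OccursAt (x ∷ v) (suc i) → OccursAt v i
  occursAt-suc (suc j , suc k , p , q , r) = j , k , suc-injective p , suc-injective q , r

  -- The decision procedure is arbitrary so that the induction can pass to the one it induces on the
  -- tail.
  count-occursAt : ∀ (v : Vec (Fin m) n) (occ? : ∀ i → Dec (OccursAt v i)) →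
    count occ? (allFin n) ≡ occ (toWord v)
  count-occursAt []          occ? = refl
  count-occursAt {n = suc n} (x ∷ v) occ? = begin
    count occ? (allFin (suc n)) ≡⟨ count-∷ occ? zero (tabulate suc) ⟩
    indicator (occ? zero) + count occ? (tabulate suc)
      ≡⟨ cong (indicator (occ? zero) +_) (count-tabulate occ? occ?′ suc id (λ _ → occursAt-suc {v = v}) λ _ → up) ⟩
    indicator (occ? zero) + count occ?′ (allFin n) ≡⟨ cong (indicator (occ? zero) +_) (count-occursAt v occ?′) ⟩
    indicator (occ? zero) + occ (toWord v) ≡⟨ atHead v occ? ⟩
    occ (toWord (x ∷ v)) ∎
    where
    open ≡-Reasoning
    up : ∀ {i} → OccursAt v i → OccursAt (x ∷ v) (suc i)
    up (j , k , p , q , r) = suc j , suc k , cong suc p , cong suc q , r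
    occ?′ : ∀ i → Dec (OccursAt v i)
    occ?′ i with occ? (suc i)
    ... | yes o = yes (occursAt-suc {v = v} o)
    ... | no ¬o = no (¬o ∘ up)
    atHead : ∀ {n} (v : Vec _ n) (occ? : ∀ i → Dec (OccursAt (x ∷ v) i)) →
           indicator (occ? zero) + occ (toWord v) ≡ occ (toWord (x ∷ v))
    atHead []          occ? = trans (+-identityʳ _) (indicator-no (occ? zero) λ { (zero , _ , () , _) ; (suc () , _) })
    atHead (y ∷ [])    occ? = trans (+-identityʳ _)
      (indicator-no (occ? zero) λ { (_ , zero , _ , () , _) ; (_ , suc zero , _ , () , _) })
    atHead (y ∷ z ∷ v) occ? = cong (_+ occ (toWord (y ∷ z ∷ v))) (indicator-cong (occ? zero) _
      (λ { (suc zero , suc (suc zero) , _ , _ , r) → r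
         ; (zero , _ , () , _)
         ; (suc (suc _) , _ , () , _)
         ; (_ , zero , _ , () , _)
         ; (_ , suc zero , _ , () , _)
         ; (_ , suc (suc (suc _)) , _ , () , _) })
      (λ r → suc zero , suc (suc zero) , refl , refl , r))

  -- Complete lists, without repetition, of the avoiders and of the pairs to be glued

  vectors-complete : ∀ (v : Vec (Fin m) n) → v ∈ vectors m n
  vectors-complete []      = here refl
  vectors-complete (x ∷ v) = ∈-cartesianProductWith⁺ _∷_ (∈-allFin x) (vectors-complete v)

  vectors-unique : ∀ m n → Unique (vectors m n)
  vectors-unique m zero    = [] ∷ []
  vectors-unique m (suc n) = Unique.cartesianProductWith⁺ _∷_ Vec.∷-injective (Unique.allFin⁺ m) (vectors-unique m n)

  avoidingPermutations : ∀ n → List (Word n)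
  avoidingPermutations n = filter avoids132? (permutations n)

  avoiders : ℕ → List (List ℕ)
  avoiders n = map toWord (avoidingPermutations n)

  avoiders-unique : ∀ n → Unique (avoiders n)
  avoiders-unique n = Unique.map⁺ toWord-injective
    (Unique.filter⁺ avoids132? (Unique.filter⁺ unique? (vectors-unique n n)))

  ∈-avoiders⁻ : ∀ {w} → w ∈ avoiders n → Avoider n w
  ∈-avoiders⁻ {n} w∈ with ∈-map⁻ toWord w∈
  ... | π , π∈ , refl with ∈-filter⁻ avoids132? {xs = permutations n} π∈
  ... | π∈′ , av = avoider (length-toWord π) (bounded-toWord π)
    (unique-toWord⁺ (proj₂ (∈-filter⁻ unique? {xs = vectors n n} π∈′))) (avoids-toWord⁺ π av)

  ∈-avoiders⁺ : ∀ {w} → Avoider n w → w ∈ avoiders n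
  ∈-avoiders⁺ (avoider size bounded w! av) with toWord-surjective size bounded
  ... | π , refl = ∈-map⁺ toWord (∈-filter⁺ avoids132?
    (∈-filter⁺ unique? (vectors-complete π) (unique-toWord⁻ π w!)) (avoids-toWord⁻ π av))

  splitsAt : ∀ n → Fin (suc n) → List (List ℕ × List ℕ)
  splitsAt n i = cartesianProduct (avoiders (toℕ i)) (avoiders (n ∸ toℕ i))

  splits : ℕ → List (List ℕ × List ℕ)
  splits n = concat (tabulate (splitsAt n))

  ∈-splitsAt⁻ : ∀ {i : Fin (suc n)} {σ τ} → (σ , τ) ∈ splitsAt n i → Avoider (toℕ i) σ × Avoider (n ∸ toℕ i) τ
  ∈-splitsAt⁻ {n} {i} στ∈ with ∈-cartesianProduct⁻ (avoiders (toℕ i)) _ στ∈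
  ... | σ∈ , τ∈ = ∈-avoiders⁻ σ∈ , ∈-avoiders⁻ τ∈

  ∈-splits⁻ : ∀ {σ τ} → (σ , τ) ∈ splits n → Avoider (length σ) σ × Avoider (length τ) τ × length σ + length τ ≡ n
  ∈-splits⁻ {n} {σ} {τ} στ∈ with ∈-concat⁻′ (tabulate (splitsAt n)) στ∈
  ... | _ , στ∈′ , ps∈ with ∈-tabulate⁻ {f = splitsAt n} ps∈
  ... | i , refl with ∈-splitsAt⁻ {n} {i} στ∈′
  ... | σ-av@(avoider σ≡ _ _ _) , τ-av@(avoider τ≡ _ _ _) =
    subst (λ k → Avoider k σ) (sym σ≡) σ-av , subst (λ k → Avoider k τ) (sym τ≡) τ-av ,
    trans (cong₂ _+_ σ≡ τ≡) (m+[n∸m]≡n (s≤s⁻¹ (Fin.toℕ<n i)))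

  ∈-splits⁺ : ∀ {σ τ} → Avoider (length σ) σ → Avoider (length τ) τ → (σ , τ) ∈ splits (length σ + length τ)
  ∈-splits⁺ {σ} {τ} σ-av τ-av = ∈-concat⁺′ (∈-cartesianProduct⁺
      (∈-avoiders⁺ (subst (λ k → Avoider k σ) (sym i≡) σ-av))
      (∈-avoiders⁺ (subst (λ k → Avoider k τ) (sym (trans (cong (length σ + length τ ∸_) i≡)
        (m+n∸m≡n (length σ) _))) τ-av)))
    (∈-tabulate⁺ {f = splitsAt (length σ + length τ)} i)
    where
    σ<n : length σ < suc (length σ + length τ)
    σ<n = s≤s (m≤m+n _ _)
    i = fromℕ< σ<n
    i≡ : toℕ i ≡ length σ
    i≡ = Fin.toℕ-fromℕ< σ<n

  splits-unique : ∀ n → Unique (splits n)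
  splits-unique n = Unique.concat⁺
    (All.tabulate⁺ λ i → Unique.cartesianProduct⁺ (avoiders-unique (toℕ i)) (avoiders-unique (n ∸ toℕ i)))
    -- The length of the first component recovers the index of a block, so distinct blocks are
    -- disjoint.
    (AllPairs.tabulate⁺ {f = splitsAt n} λ {i} {j} i≢j (p , q) → i≢j (Fin.toℕ-injective
      (trans (sym (Avoider.size (proj₁ (∈-splitsAt⁻ {n} {i} p)))) (Avoider.size (proj₁ (∈-splitsAt⁻ {n} {j} q))))))

  -- Injectivity is asked for on the list only, because `glue` is not injective on arbitrary pairs
  -- of lists.
  unique-map⁺ : ∀ {f : A → B} {xs} → (∀ {x y} → x ∈ xs → y ∈ xs → f x ≡ f y → x ≡ y) →
    Unique xs → Unique (map f xs)
  unique-map⁺ inj []           = []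
  unique-map⁺ inj (x≢xs ∷ xs!) =
    All.map⁺ (All.tabulate λ y∈xs fx≡fy → All.lookup x≢xs y∈xs (inj (here refl) (there y∈xs) fx≡fy))
    ∷ unique-map⁺ (λ x∈ y∈ → inj (there x∈) (there y∈)) xs!

  -- Neither list has repetitions, so it is enough that they have the same elements.
  avoiders-suc : ∀ n → avoiders (suc n) ↭ map glue (splits n)
  avoiders-suc n = ∼bag⇒↭ (unique∧set⇒bag (avoiders-unique (suc n)) (unique-map⁺ glue-inj (splits-unique n))
    (mk⇔ to from))
    where
    glue-inj : ∀ {p q} → p ∈ splits n → q ∈ splits n → glue p ≡ glue q → p ≡ q
    glue-inj p∈ q∈ with ∈-splits⁻ {n} p∈ | ∈-splits⁻ {n} q∈
    ... | avoider _ σ< _ _ , _ , eq | avoider _ σ′< _ _ , _ , eq′ = glue-injective σ< σ′< (trans eq (sym eq′))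
    to : ∀ {w} → w ∈ avoiders (suc n) → w ∈ map glue (splits n)
    to w∈ with avoider-split (∈-avoiders⁻ w∈)
    ... | σ , τ , σ-av , τ-av , refl , refl = ∈-map⁺ glue (∈-splits⁺ σ-av τ-av)
    from : ∀ {w} → w ∈ map glue (splits n) → w ∈ avoiders (suc n)
    from w∈ with ∈-map⁻ glue w∈
    ... | (σ , τ) , στ∈ , refl with ∈-splits⁻ {n} στ∈
    ... | σ-av , τ-av , refl = ∈-avoiders⁺ (glue-avoider σ-av τ-av)

open Words
open Enumeration

open import Data.Integer.Base as ℤ using (+_) renaming (_-_ to _-ℤ_)
import Data.Integer.Properties as ℤ

private variable c ℓ : Level

-- Power series over a commutative ring

module PowerSeries (R : CommutativeRing c ℓ) where
  open CommutativeRing R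
  open import Algebra.Properties.Semiring.Sum semiring
  open import Algebra.Properties.CommutativeSemigroup +-commutativeSemigroup using ()
    renaming (x∙yz≈y∙xz to +-swap)
  open import Relation.Binary.Reasoning.Setoid setoid
  open RawRing (powerSeries rawRing) public using () renaming
    ( Carrier to Series; _≈_ to _≋_; _+_ to _⊕_; _*_ to _⊛_; -_ to ⊖_; 0# to 𝟘; 1# to 𝟙)

  tail : Series → Series
  tail f n = f (suc n)

  ⊛-cong : ∀ {f f′ g g′} → f ≋ f′ → g ≋ g′ → f ⊛ g ≋ f′ ⊛ g′
  ⊛-cong f≋f′ g≋g′ n = sum-cong-≋ {suc n} λ i → *-cong (f≋f′ (toℕ i)) (g≋g′ (n ∸ toℕ i))

  ⊛-zeroˡ : ∀ g → 𝟘 ⊛ g ≋ 𝟘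
  ⊛-zeroˡ g zero    = trans (+-identityʳ _) (zeroˡ _)
  ⊛-zeroˡ g (suc n) = trans (+-cong (zeroˡ _) (⊛-zeroˡ g n)) (+-identityˡ _)

  ⊛-identityˡ : ∀ g → 𝟙 ⊛ g ≋ g
  ⊛-identityˡ g zero    = trans (+-identityʳ _) (*-identityˡ _)
  ⊛-identityˡ g (suc n) = trans (+-cong (*-identityˡ _) (⊛-zeroˡ g n)) (+-identityʳ _)

  ⊛-distribʳ : ∀ h f g → (f ⊕ g) ⊛ h ≋ (f ⊛ h) ⊕ (g ⊛ h)
  ⊛-distribʳ h f g n = trans
    (sum-cong-≋ {suc n} λ i → distribʳ (h (n ∸ toℕ i)) (f (toℕ i)) (g (toℕ i)))
    (∑-distrib-+ {suc n} (λ i → f (toℕ i) * h (n ∸ toℕ i)) (λ i → g (toℕ i) * h (n ∸ toℕ i)))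

  ⊛-scale : ∀ a g h → (λ n → a * g n) ⊛ h ≋ (λ n → a * (g ⊛ h) n)
  ⊛-scale a g h n = trans
    (sum-cong-≋ {suc n} λ i → *-assoc a (g (toℕ i)) (h (n ∸ toℕ i)))
    (sym (*-distribˡ-sum {suc n} a λ i → g (toℕ i) * h (n ∸ toℕ i)))

  -- The product unfolds by definition along its left factor. Unfolding along the right factor as
  -- well makes commutativity an induction.
  ⊛-unfoldʳ : ∀ f g n → (f ⊛ g) (suc n) ≈ f (suc n) * g 0 + (f ⊛ tail g) n
  ⊛-unfoldʳ f g zero    = +-swap _ _ _
  ⊛-unfoldʳ f g (suc n) = begin
    f 0 * g (2 ℕ.+ n) + (tail f ⊛ g) (suc n)
      ≈⟨ +-congˡ (⊛-unfoldʳ (tail f) g n) ⟩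
    f 0 * g (2 ℕ.+ n) + (f (2 ℕ.+ n) * g 0 + (tail f ⊛ tail g) n)
      ≈⟨ +-swap _ _ _ ⟩
    f (2 ℕ.+ n) * g 0 + (f ⊛ tail g) (suc n) ∎

  ⊛-comm : ∀ f g → f ⊛ g ≋ g ⊛ f
  ⊛-comm f g zero    = +-congʳ (*-comm _ _)
  ⊛-comm f g (suc n) = begin
    f 0 * g (suc n) + (tail f ⊛ g) n ≈⟨ +-cong (*-comm _ _) (⊛-comm (tail f) g n) ⟩
    g (suc n) * f 0 + (g ⊛ tail f) n ≈⟨ ⊛-unfoldʳ g f n ⟨
    (g ⊛ f) (suc n) ∎

  -- The induction rests on `tail (f ⊛ g)` being, by definition, `f 0` times `tail g` plus
  -- `tail f ⊛ g`.
  ⊛-assoc : ∀ f g h → (f ⊛ g) ⊛ h ≋ f ⊛ (g ⊛ h)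
  ⊛-assoc f g h zero = +-congʳ (trans (*-congʳ (+-identityʳ _)) 
    (trans (*-assoc _ _ _) (*-congˡ (sym (+-identityʳ _)))))
  ⊛-assoc f g h (suc n) = begin
    (f ⊛ g) 0 * h (suc n) + (tail (f ⊛ g) ⊛ h) n
      ≈⟨ +-cong (*-congʳ (+-identityʳ _)) (⊛-distribʳ h (λ m → f 0 * g (suc m)) (tail f ⊛ g) n) ⟩
    (f 0 * g 0) * h (suc n) + (((λ m → f 0 * g (suc m)) ⊛ h) n + ((tail f ⊛ g) ⊛ h) n)
      ≈⟨ +-cong (*-assoc _ _ _) (+-cong (⊛-scale (f 0) (tail g) h n) (⊛-assoc (tail f) g h n)) ⟩
    f 0 * (g 0 * h (suc n)) + (f 0 * (tail g ⊛ h) n + (tail f ⊛ (g ⊛ h)) n)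
      ≈⟨ +-assoc _ _ _ ⟨
    f 0 * (g 0 * h (suc n)) + f 0 * (tail g ⊛ h) n + (tail f ⊛ (g ⊛ h)) n
      ≈⟨ +-congʳ (distribˡ _ _ _) ⟨
    (f ⊛ (g ⊛ h)) (suc n) ∎

  powerSeriesRing : CommutativeRing c ℓ
  powerSeriesRing = record
    { RawRing (powerSeries rawRing)
    ; isCommutativeRing = record
      { isRing = record
        { +-isAbelianGroup = record
          { isGroup = record
            { isMonoid = record
              { isSemigroup = record
                { isMagma = record
                  { isEquivalence = record
                    { refl  = λ n → refl
                    ; sym   = λ p n → sym (p n)
                    ; trans = λ p q n → trans (p n) (q n)
                    }
                  ; ∙-cong = λ p q n → +-cong (p n) (q n)
                  }
                ; assoc = λ f g h n → +-assoc _ _ _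
                }
              ; identity = (λ f n → +-identityˡ _) , (λ f n → +-identityʳ _)
              }
            ; inverse = (λ f n → -‿inverseˡ _) , (λ f n → -‿inverseʳ _)
            ; ⁻¹-cong = λ p n → -‿cong (p n)
            }
          ; comm = λ f g n → +-comm _ _
          }
        ; *-cong = ⊛-cong
        ; *-assoc = ⊛-assoc
        ; *-identity = ⊛-identityˡ , λ f n → trans (⊛-comm f 𝟙 n) (⊛-identityˡ f n)
        ; distrib = (λ f g h n → trans (⊛-comm f (g ⊕ h) n) (trans (⊛-distribʳ f g h n)
                      (+-cong (⊛-comm g f n) (⊛-comm h f n))))
                  , ⊛-distribʳ
        }
      ; *-comm = ⊛-comm
      }
    }

  x′ : Series
  x′ = variableₛ rawRing

  const : Carrier → Series
  const = constant rawRing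

  const-⊛ : ∀ a f → const a ⊛ f ≋ (λ n → a * f n)
  const-⊛ a f zero    = +-identityʳ _
  const-⊛ a f (suc n) = trans (+-congˡ (⊛-zeroˡ f n)) (+-identityʳ _)

  x-⊛-zero : ∀ f → (x′ ⊛ f) 0 ≈ 0#
  x-⊛-zero f = trans (+-identityʳ _) (zeroˡ _)

  x-⊛-suc : ∀ f n → (x′ ⊛ f) (suc n) ≈ f n
  x-⊛-suc f n = trans (+-cong (zeroˡ _) (trans (⊛-cong {g = f} tail-x (λ _ → refl) n)
    (⊛-identityˡ f n))) (+-identityˡ _)
    where
    tail-x : tail x′ ≋ 𝟙
    tail-x zero    = refl
    tail-x (suc _) = refl

-- Ring identities: the quadratic equation, cancellation, convolution recurrences

module RingLemmas (R : CommutativeRing c ℓ) where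
  open CommutativeRing R
  open RingNotation rawRing using (_·_; _^_)
  open import Algebra.Properties.Group +-group using () renaming (//-rightDividesʳ to +-cancel-minus)
  open import Algebra.Properties.CommutativeSemigroup +-commutativeSemigroup using (xy∙z≈xz∙y)
  open import Algebra.Solver.Ring.NaturalCoefficients.Default commutativeSemiring
    using (solve; con; _:+_; _:*_; _:^_; _:=_; Polynomial)
  open import Algebra.Properties.Semiring.Sum semiring
  open import Algebra.Properties.Semiring.Exp semiring using (^-congˡ; ^-congʳ; ^-homo-*)
  open import Algebra.Properties.CommutativeSemiring.Exp commutativeSemiring using (^-distrib-*)
  open import Relation.Binary.Reasoning.Setoid setoid
  open PowerSeries R using (_⊛_)

  infixr 9 _:·_
  -- Unfolds in the same way as `_·_`, so that the solver can express natural multiples.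
  _:·_ : ∀ {n} → ℕ → Polynomial n → Polynomial n
  zero  :· p = con 0
  suc n :· p = p :+ n :· p

  +-move : ∀ {p q r} → p + q ≈ r → p ≈ r - q
  +-move {p} {q} eq = trans (sym (+-cancel-minus q p)) (+-congʳ eq)

  +-move₂ : ∀ {p q r s t} → p + q + r ≈ s + t → p ≈ s - r + t - q
  +-move₂ eq = +-move (trans (+-move eq) (xy∙z≈xz∙y _ _ _))

  module _ {x y G S : Carrier} (S-def : S ≈ 1# - x * (2 · (1# + y * G))) where

    private
      -- The solver works over semirings, so `S` enters the computations through this
      -- subtraction-free form.
      S+ : S + x * (2 · (1# + y * G)) ≈ 1#
      S+ = trans (+-congʳ S-def) (trans (+-assoc _ _ _) (trans (+-congˡ (-‿inverseˡ _)) (+-identityʳ _)))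

    root⇒quotient : (1# + G) * (2 · (x * y)) ≈ 1# - 2 · x + 2 · (x * y) - S
    root⇒quotient = +-move₂ (begin
      (1# + G) * (2 · (x * y)) + S + 2 · x
        ≈⟨ solve 4 (λ x y G S → (con 1 :+ G) :* (2 :· (x :* y)) :+ S :+ 2 :· x :=
                     S :+ x :* (2 :· (con 1 :+ y :* G)) :+ 2 :· (x :* y)) refl x y G S ⟩
      S + x * (2 · (1# + y * G)) + 2 · (x * y) ≈⟨ +-congʳ S+ ⟩
      1# + 2 · (x * y) ∎)

    -- `S` is minus the derivative at `G` of xyT² - (1 - 2x)T + x. At a root the square of the
    -- derivative is the discriminant (1 - 2x)² - 4x²y.
    root-square : G ≈ x * (1# + (G + G) + y * (G * G)) →
                  S * S ≈ 1# - 4 · x + 4 · x ^ 2 - 4 · (x ^ 2 * y)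
    root-square G-eq = +-move₂ (begin
      S * S + 4 · (x ^ 2 * y) + 4 · x
        ≈⟨ solve 3 (λ x y S → S :* S :+ 4 :· (x :^ 2 :* y) :+ 4 :· x :=
                     S :* S :+ (4 :· (x :* y)) :* x :+ 4 :· x :* con 1) refl x y S ⟩
      S * S + 4 · (x * y) * x + 4 · x * 1#
        -- One factor x of 4x²y is replaced through `GS`, and the 1 in 4x through `S+`; this
        -- completes the square up to 4x².
        ≈⟨ +-cong (+-congˡ (*-congˡ (sym GS))) (*-congˡ (sym S+)) ⟩
      S * S + 4 · (x * y) * (G * S + x * (y * (G * G))) + 4 · x * (S + x * (2 · (1# + y * G)))
        ≈⟨ solve 4 (λ x y G S →
             S :* S :+ 4 :· (x :* y) :* (G :* S :+ x :* (y :* (G :* G))) :+ 4 :· x :*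
               (S :+ x :* (2 :· (con 1 :+ y :* G)))
             := (S :+ x :* (2 :· (con 1 :+ y :* G))) :* (S :+ x :* (2 :· (con 1 :+ y :* G))) :+ 4 :· x :^ 2) refl x y G S ⟩
      (S + x * (2 · (1# + y * G))) * (S + x * (2 · (1# + y * G))) + 4 · x ^ 2
        ≈⟨ +-congʳ (trans (*-cong S+ S+) (*-identityˡ 1#)) ⟩
      1# + 4 · x ^ 2 ∎)
      where
      GS : G * S + x * (y * (G * G)) ≈ x
      GS = +-cancelʳ (x * (G + G) + x * (y * (G * G))) _ _ (begin
        G * S + x * (y * (G * G)) + (x * (G + G) + x * (y * (G * G)))
          ≈⟨ solve 4 (λ x y G S → G :* S :+ x :* (y :* (G :* G)) :+ (x :* (G :+ G) :+ x :* (y :* (G :* G)))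
               := G :* (S :+ x :* (2 :· (con 1 :+ y :* G)))) refl x y G S ⟩
        G * (S + x * (2 · (1# + y * G))) ≈⟨ trans (*-congˡ S+) (*-identityʳ G) ⟩
        G                                ≈⟨ G-eq ⟩
        x * (1# + (G + G) + y * (G * G))
          ≈⟨ solve 3 (λ x y G → x :* (con 1 :+ (G :+ G) :+ y :* (G :* G))
               := x :+ (x :* (G :+ G) :+ x :* (y :* (G :* G)))) refl x y G ⟩
        x + (x * (G + G) + x * (y * (G * G))) ∎)
        where open import Algebra.Properties.Group +-group using () renaming (∙-cancelʳ to +-cancelʳ)

  -- Turns a linear recursion into a quotient by 1 - t.
  *-1-minus : ∀ {a t b} → a ≈ b + t * a → a * (1# - t) ≈ b
  *-1-minus {a} {t} {b} eq = sym (+-move-b)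
    where
    +-move-b : b ≈ a * (1# - t)
    +-move-b = begin
      b              ≈⟨ +-move (sym eq) ⟩
      a - t * a      ≈⟨ +-cong (*-identityʳ a) (-‿cong (*-comm a t)) ⟨
      a * 1# - a * t ≈⟨ x[y-z]≈xy-xz a 1# t ⟨
      a * (1# - t)   ∎
      where open import Algebra.Properties.Ring ring using (x[y-z]≈xy-xz)

  *-cancel-^ : ∀ {u v a b} → u * v ≈ 1# → ∀ k → a * u ^ k ≈ b * u ^ k → a ≈ b
  *-cancel-^ {u} {v} {a} {b} uv k eq = trans (sym (absorb a)) (trans (*-congʳ eq) (absorb b))
    where
    1^ : ∀ k → 1# ^ k ≈ 1#
    1^ zero    = refl
    1^ (suc k) = trans (*-identityˡ _) (1^ k)
    absorb : ∀ a → a * u ^ k * v ^ k ≈ a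
    absorb a = begin
      a * u ^ k * v ^ k   ≈⟨ *-assoc _ _ _ ⟩
      a * (u ^ k * v ^ k) ≈⟨ *-congˡ (^-distrib-* u v k) ⟨
      a * (u * v) ^ k     ≈⟨ *-congˡ (trans (^-congˡ k uv) (1^ k)) ⟩
      a * 1#              ≈⟨ *-identityʳ a ⟩
      a                   ∎

  -- The exponents balance: the product of the terms i and r - i carries (2i + 1) + 2(r - i) + 1 =
  -- 2r + 2 factors, and the recurrence for `g` supplies one more `u` against one more `x`. This
  -- gives 2(r + 1) + 1 on each side.
  convolution-recurrence : ∀ {u x} (g c : ℕ → Carrier) →
    g 0 * u ≈ x → c 0 ≈ 1# →
    (∀ r → g (suc r) * u ≈ x * (g ⊛ g) r) → (∀ r → c (suc r) ≈ (c ⊛ c) r) →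
    ∀ r → g r * u ^ (2 ℕ.* r ℕ.+ 1) ≈ c r * x ^ (2 ℕ.* r ℕ.+ 1)
  convolution-recurrence {u} {x} g c g0 c0 g-suc c-suc = <-rec _ step
    where
    e : ℕ → ℕ
    e r = 2 ℕ.* r ℕ.+ 1

    e-split : ∀ {r} (i : Fin (suc r)) → e (suc r) ≡ suc (e (toℕ i) ℕ.+ e (r ∸ toℕ i))
    e-split {r} i = ≡.trans (≡.cong (λ s → e (suc s)) (≡.sym (ℕ.m+[n∸m]≡n (ℕ.s≤s⁻¹ (Fin.toℕ<n i)))))
      (lemma (toℕ i) (r ∸ toℕ i))
      where
      lemma : ∀ i j → 2 ℕ.* suc (i ℕ.+ j) ℕ.+ 1 ≡ suc ((2 ℕ.* i ℕ.+ 1) ℕ.+ (2 ℕ.* j ℕ.+ 1))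
      lemma = solve-∀

    distribute : ∀ (f : ℕ → Carrier) z r → (f ⊛ f) r * z ^ (e (suc r) ∸ 1) ≈
      sum {suc r} λ i → (f (toℕ i) * z ^ e (toℕ i)) * (f (r ∸ toℕ i) * z ^ e (r ∸ toℕ i))
    distribute f z r = trans (*-distribʳ-sum {suc r} _ (λ i → f (toℕ i) * f (r ∸ toℕ i)))
      (sum-cong-≋ {suc r} λ i → begin
        f (toℕ i) * f (r ∸ toℕ i) * z ^ (e (suc r) ∸ 1)
          ≈⟨ *-congˡ (trans (^-congʳ z (≡.cong ℕ.pred (e-split i))) (^-homo-* z (e (toℕ i)) (e (r ∸ toℕ i)))) ⟩
        f (toℕ i) * f (r ∸ toℕ i) * (z ^ e (toℕ i) * z ^ e (r ∸ toℕ i))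
          ≈⟨ solve 4 (λ a b c d → a :* b :* (c :* d) := a :* c :* (b :* d)) refl _ _ _ _ ⟩
        (f (toℕ i) * z ^ e (toℕ i)) * (f (r ∸ toℕ i) * z ^ e (r ∸ toℕ i)) ∎)

    step : ∀ r → (∀ {s} → s ℕ.< r → g s * u ^ e s ≈ c s * x ^ e s) → g r * u ^ e r ≈ c r * x ^ e r
    step zero    _  = trans (*-congˡ (*-identityʳ u)) (trans g0
      (trans (sym (*-identityʳ x)) (trans (sym (*-identityˡ _)) (*-congʳ (sym c0)))))
    step (suc r) ih = begin
      g (suc r) * u ^ e (suc r)   ≈⟨ *-assoc _ _ _ ⟨
      g (suc r) * u * u ^ k       ≈⟨ *-congʳ (g-suc r) ⟩
      x * (g ⊛ g) r * u ^ k       ≈⟨ *-assoc _ _ _ ⟩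
      x * ((g ⊛ g) r * u ^ k)     ≈⟨ *-congˡ (distribute g u r) ⟩
      x * sum {suc r} (λ i → (g (toℕ i) * u ^ e (toℕ i)) * (g (r ∸ toℕ i) * u ^ e (r ∸ toℕ i)))
        ≈⟨ *-congˡ (sum-cong-≋ {suc r} λ i → *-cong (ih (Fin.toℕ<n i)) (ih (ℕ.s≤s (ℕ.m∸n≤m r (toℕ i))))) ⟩
      x * sum {suc r} (λ i → (c (toℕ i) * x ^ e (toℕ i)) * (c (r ∸ toℕ i) * x ^ e (r ∸ toℕ i)))
        ≈⟨ *-congˡ (distribute c x r) ⟨
      x * ((c ⊛ c) r * x ^ k)     ≈⟨ *-congˡ (*-congʳ (c-suc r)) ⟨
      x * (c (suc r) * x ^ k)     ≈⟨ solve 3 (λ a b d → a :* (b :* d) := b :* (a :* d)) refl x _ _ ⟩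
      c (suc r) * x ^ e (suc r)   ∎
      where k = e (suc r) ∸ 1

-- From the first-order Catalan recurrence to the convolution

module CatalanConvolution (R : CommutativeRing c ℓ) where
  open CommutativeRing R
  open PowerSeries R using (_⊛_; ⊛-comm; ⊛-scale; ⊛-cong; ⊛-distribʳ)
  open import Algebra.Properties.Semiring.Sum semiring
  open import Algebra.Solver.Ring.NaturalCoefficients.Default commutativeSemiring
    using (solve; con; _:+_; _:*_; _:=_)
  open import Relation.Binary.Reasoning.Setoid setoid

  module _
    (ι : ℕ → Carrier) (ι-zero : ι 0 ≈ 0#) (ι-suc : ∀ n → ι (suc n) ≈ 1# + ι n)
    (ι-cancel : ∀ n {a b} → ι (suc n) * a ≈ ι (suc n) * b → a ≈ b)
    (c : ℕ → Carrier) (c-zero : c 0 ≈ 1#)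
    (c-suc : ∀ n → ι (2 ℕ.+ n) * c (suc n) ≈ (ι 4 * ι n + ι 2) * c n)
    where

    private
      ι-+ : ∀ m n → ι (m ℕ.+ n) ≈ ι m + ι n
      ι-+ zero    n = sym (trans (+-congʳ ι-zero) (+-identityˡ _))
      ι-+ (suc m) n = trans (ι-suc _) (trans (+-congˡ (ι-+ m n))
        (trans (sym (+-assoc _ _ _)) (+-congʳ (sym (ι-suc m)))))

      two : ι 2 ≈ 1# + 1#
      two = trans (ι-suc 1) (+-congˡ (trans (ι-suc 0) (trans (+-congˡ ι-zero) (+-identityʳ _))))

      four : ι 4 ≈ 1# + 1# + (1# + 1#)
      four = trans (ι-+ 2 2) (+-cong two two)

      -- The derivation t d/dt.
      θ : (ℕ → Carrier) → ℕ → Carrier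
      θ f n = ι n * f n

      -- The Leibniz rule: n is split as i + (n - i) in every summand, and the two halves agree by
      -- commutativity.
      θ-square : ∀ n → θ (c ⊛ c) n ≈ (1# + 1#) * (θ c ⊛ c) n
      θ-square n = begin
        ι n * (c ⊛ c) n ≈⟨ *-distribˡ-sum {suc n} (ι n) (λ i → c (toℕ i) * c (n ∸ toℕ i)) ⟩
        sum {suc n} (λ i → ι n * (c (toℕ i) * c (n ∸ toℕ i)))
          ≈⟨ sum-cong-≋ {suc n} (λ i → begin
               ι n * (c (toℕ i) * c (n ∸ toℕ i))
                 ≈⟨ *-congʳ (trans (reflexive (≡.cong ι (≡.sym (ℕ.m+[n∸m]≡n (ℕ.s≤s⁻¹ (Fin.toℕ<n i))))))
                      (ι-+ (toℕ i) (n ∸ toℕ i))) ⟩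
               (ι (toℕ i) + ι (n ∸ toℕ i)) * (c (toℕ i) * c (n ∸ toℕ i))
                 ≈⟨ solve 4 (λ a b x y → (a :+ b) :* (x :* y) := (a :* x) :* y :+ x :* (b :* y)) refl _ _ _ _ ⟩
               θ c (toℕ i) * c (n ∸ toℕ i) + c (toℕ i) * θ c (n ∸ toℕ i) ∎) ⟩
        sum {suc n} (λ i → θ c (toℕ i) * c (n ∸ toℕ i) + c (toℕ i) * θ c (n ∸ toℕ i))
          ≈⟨ ∑-distrib-+ {suc n} (λ i → θ c (toℕ i) * c (n ∸ toℕ i)) (λ i → c (toℕ i) * θ c (n ∸ toℕ i)) ⟩
        (θ c ⊛ c) n + (c ⊛ θ c) n ≈⟨ +-congˡ (⊛-comm c (θ c) n) ⟩
        (θ c ⊛ c) n + (θ c ⊛ c) n ≈⟨ solve 1 (λ a → a :+ a := (con 1 :+ con 1) :* a) refl _ ⟩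
        (1# + 1#) * (θ c ⊛ c) n ∎

      -- (n + 1)cₙ, which for the Catalan numbers is the central binomial coefficient; the
      -- first-order recurrence expresses its successor through `θ c` and `c`.
      weighted : ℕ → Carrier
      weighted n = θ c n + c n

      weighted-suc : ∀ n → weighted (suc n) ≈ ι 4 * θ c n + ι 2 * c n
      weighted-suc n = begin
        ι (suc n) * c (suc n) + c (suc n)
          ≈⟨ solve 2 (λ a b → a :* b :+ b := (con 1 :+ a) :* b) refl _ _ ⟩
        (1# + ι (suc n)) * c (suc n) ≈⟨ *-congʳ (ι-suc (suc n)) ⟨
        ι (2 ℕ.+ n) * c (suc n)      ≈⟨ c-suc n ⟩
        (ι 4 * ι n + ι 2) * c n      ≈⟨ trans (distribʳ _ _ _) (+-congʳ (*-assoc _ _ _)) ⟩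
        ι 4 * θ c n + ι 2 * c n      ∎

      -- Beyond the summand i = 0 the recurrence leaves 4(θ c ⊛ c) + 2(c ⊛ c), which by `θ-square`
      -- is twice θ(c ⊛ c) + c ⊛ c.
      weighted-⊛ : ∀ n → (weighted ⊛ c) (suc n) ≈ c (suc n) + (1# + 1#) * (ι (suc n) * (c ⊛ c) n)
      weighted-⊛ n = begin
        (ι 0 * c 0 + c 0) * c (suc n) + ((λ m → weighted (suc m)) ⊛ c) n
          ≈⟨ +-cong (trans (*-congʳ head) (*-identityˡ _)) (trans (⊛-cong {g = c} weighted-suc (λ _ → refl) n)
               (trans (⊛-distribʳ c (λ m → ι 4 * θ c m) (λ m → ι 2 * c m) n)
                 (+-cong (⊛-scale (ι 4) (θ c) c n) (⊛-scale (ι 2) c c n)))) ⟩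
        c (suc n) + (ι 4 * (θ c ⊛ c) n + ι 2 * (c ⊛ c) n)
          ≈⟨ +-congˡ (+-cong (*-congʳ four) (*-congʳ two)) ⟩
        c (suc n) + ((1# + 1# + (1# + 1#)) * (θ c ⊛ c) n + (1# + 1#) * (c ⊛ c) n)
          ≈⟨ +-congˡ (solve 2 (λ a b → (con 1 :+ con 1 :+ (con 1 :+ con 1)) :* a :+ (con 1 :+ con 1) :* b
               := (con 1 :+ con 1) :* ((con 1 :+ con 1) :* a :+ b)) refl _ _) ⟩
        c (suc n) + (1# + 1#) * ((1# + 1#) * (θ c ⊛ c) n + (c ⊛ c) n)
          ≈⟨ +-congˡ (*-congˡ (+-congʳ (θ-square n))) ⟨
        c (suc n) + (1# + 1#) * (ι n * (c ⊛ c) n + (c ⊛ c) n)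
          ≈⟨ +-congˡ (*-congˡ (trans (solve 2 (λ a b → a :* b :+ b := (con 1 :+ a) :* b) refl _ _)
               (*-congʳ (sym (ι-suc n))))) ⟩
        c (suc n) + (1# + 1#) * (ι (suc n) * (c ⊛ c) n) ∎
        where
        head : ι 0 * c 0 + c 0 ≈ 1#
        head = trans (+-cong (trans (*-congʳ ι-zero) (zeroˡ _)) c-zero) (+-identityˡ _)

      twice-weighted : ∀ n → (1# + 1#) * (weighted ⊛ c) n ≈ ι (2 ℕ.+ n) * (c ⊛ c) n
      twice-weighted n = begin
        (1# + 1#) * (weighted ⊛ c) n ≈⟨ *-congˡ (⊛-distribʳ c (θ c) c n) ⟩
        (1# + 1#) * ((θ c ⊛ c) n + (c ⊛ c) n) ≈⟨ distribˡ _ _ _ ⟩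
        (1# + 1#) * (θ c ⊛ c) n + (1# + 1#) * (c ⊛ c) n ≈⟨ +-congʳ (θ-square n) ⟨
        ι n * (c ⊛ c) n + (1# + 1#) * (c ⊛ c) n ≈⟨ distribʳ _ _ _ ⟨
        (ι n + (1# + 1#)) * (c ⊛ c) n ≈⟨ *-congʳ (trans (+-comm _ _) (+-congʳ (sym two))) ⟩
        (ι 2 + ι n) * (c ⊛ c) n ≈⟨ *-congʳ (ι-+ 2 n) ⟨
        ι (2 ℕ.+ n) * (c ⊛ c) n ∎

    -- As θ is a derivation, Σᵢ (i + 1) cᵢ cₙ₋ᵢ is (n + 2)/2 times (c ⊛ c) n; the
    -- recurrence for c evaluates the same sum as cₙ + 2n (c ⊛ c) (n − 1).
    catalan-convolution : ∀ n → c (suc n) ≈ (c ⊛ c) n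
    catalan-convolution zero = ι-cancel 1 (begin
      ι 2 * c 1               ≈⟨ c-suc 0 ⟩
      (ι 4 * ι 0 + ι 2) * c 0 ≈⟨ *-cong (trans (+-congʳ (trans (*-congˡ ι-zero) (zeroʳ _))) (+-identityˡ _)) c-zero ⟩
      ι 2 * 1#                ≈⟨ *-congˡ (trans (sym (*-identityˡ 1#)) (trans (sym (+-identityʳ _))
                                   (+-congʳ (*-cong (sym c-zero) (sym c-zero))))) ⟩
      ι 2 * (c ⊛ c) 0         ∎)
    catalan-convolution (suc n) = ι-cancel (2 ℕ.+ n) (begin
      ι (3 ℕ.+ n) * c (2 ℕ.+ n) ≈⟨ c-suc (suc n) ⟩
      (ι 4 * ι (suc n) + ι 2) * c (suc n) ≈⟨ *-congʳ (+-cong (*-congʳ four) two) ⟩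
      ((1# + 1# + (1# + 1#)) * ι (suc n) + (1# + 1#)) * c (suc n)
        ≈⟨ solve 2 (λ a b → ((con 1 :+ con 1 :+ (con 1 :+ con 1)) :* a :+ (con 1 :+ con 1)) :* b
             := (con 1 :+ con 1) :* (b :+ (con 1 :+ con 1) :* (a :* b))) refl _ _ ⟩
      (1# + 1#) * (c (suc n) + (1# + 1#) * (ι (suc n) * c (suc n)))
        -- The induction hypothesis rewrites only one of the two copies of `c (suc n)`; the other is
        -- the summand i = 0 in `weighted-⊛`.
        ≈⟨ *-congˡ (+-congˡ (*-congˡ (*-congˡ (catalan-convolution n)))) ⟩
      (1# + 1#) * (c (suc n) + (1# + 1#) * (ι (suc n) * (c ⊛ c) n)) ≈⟨ *-congˡ (weighted-⊛ n) ⟨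
      (1# + 1#) * (weighted ⊛ c) (suc n) ≈⟨ twice-weighted (suc n) ⟩
      ι (3 ℕ.+ n) * (c ⊛ c) (suc n) ∎)

-- Words weighted by y to the number of their occurrences

bothPositive : ℕ → ℕ → ℕ
bothPositive (suc _) (suc _) = 1
bothPositive _       _       = 0

bothNonempty-length : ∀ xs ys → bothNonempty xs ys ≡ bothPositive (length xs) (length ys)
bothNonempty-length []      _       = ≡.refl
bothNonempty-length (_ ∷ _) []      = ≡.refl
bothNonempty-length (_ ∷ _) (_ ∷ _) = ≡.refl

-- Expressed by lengths, the junction contributes equally to all pairs of a block, so its power of y
-- can be factored out of the block's sum.
occ-glue-size : ∀ {k l σ τ} → Avoider k σ → Avoider l τ → occ (glue (σ , τ)) ≡ bothPositive k l ℕ.+ (occ σ ℕ.+ occ τ)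
occ-glue-size {σ = σ} {τ} σ-av@(avoider ≡.refl _ _ _) τ-av@(avoider ≡.refl _ _ _) =
  ≡.trans (occ-glue σ-av τ-av) (≡.cong (ℕ._+ (occ σ ℕ.+ occ τ)) (bothNonempty-length σ τ))

module Weights (R : CommutativeRing c ℓ) (y : CommutativeRing.Carrier R) where
  open CommutativeRing R hiding (zero)
  open RingNotation rawRing using (_^_)
  open PowerSeries R using (_⊛_; 𝟙; ⊛-identityˡ; ⊛-comm)
  open import Algebra.Properties.Semiring.Sum semiring
  open import Algebra.Properties.Semiring.Exp semiring using (^-homo-*)
  open import Algebra.Properties.CommutativeSemigroup +-commutativeSemigroup using () renaming (x∙yz≈y∙xz to +-swap)
  open import Algebra.Solver.Ring.NaturalCoefficients.Default commutativeSemiring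
    using (solve; con; _:+_; _:*_; _:=_)
  open import Relation.Binary.Reasoning.Setoid setoid

  weight : List (List ℕ) → Carrier
  weight []       = 0#
  weight (w ∷ ws) = y ^ occ w + weight ws

  weight-↭ : ∀ {us vs} → us ↭ vs → weight us ≈ weight vs
  weight-↭ ↭.refl           = refl
  weight-↭ (↭.prep _ p)     = +-congˡ (weight-↭ p)
  weight-↭ (↭.swap _ _ p)   = trans (+-swap _ _ _) (+-congˡ (+-congˡ (weight-↭ p)))
  weight-↭ (↭.trans p q)    = trans (weight-↭ p) (weight-↭ q)

  glueWeight : List (List ℕ × List ℕ) → Carrier
  glueWeight ps = weight (map glue ps)

  glueWeight-++ : ∀ ps qs → glueWeight (ps ++ qs) ≈ glueWeight ps + glueWeight qs
  glueWeight-++ []       qs = sym (+-identityˡ _)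
  glueWeight-++ (p ∷ ps) qs = trans (+-congˡ (glueWeight-++ ps qs)) (sym (+-assoc _ _ _))

  glueWeight-concat : ∀ {n} (f : Fin n → List (List ℕ × List ℕ)) →
    glueWeight (concat (tabulate f)) ≈ sum {n} (glueWeight ∘ f)
  glueWeight-concat {zero}  f = refl
  glueWeight-concat {suc n} f = trans (glueWeight-++ (f zero) _) (+-congˡ (glueWeight-concat (f ∘ suc)))

  glueWeight-row : ∀ b u {vs} → (∀ {v} → v ∈ vs → occ (glue (u , v)) ≡ b ℕ.+ (occ u ℕ.+ occ v)) →
    glueWeight (map (u ,_) vs) ≈ y ^ b * (y ^ occ u * weight vs)
  glueWeight-row b u {[]}     _ = sym (trans (*-congˡ (zeroʳ _)) (zeroʳ _))
  glueWeight-row b u {v ∷ vs} h = begin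
    y ^ occ (glue (u , v)) + glueWeight (map (u ,_) vs)
      ≈⟨ +-cong (trans (reflexive (≡.cong (y ^_) (h (here ≡.refl))))
           (trans (^-homo-* y b _) (*-congˡ (^-homo-* y (occ u) (occ v)))))
           (glueWeight-row b u (h ∘ there)) ⟩
    y ^ b * (y ^ occ u * y ^ occ v) + y ^ b * (y ^ occ u * weight vs)
      ≈⟨ solve 4 (λ a b c d → a :* (b :* c) :+ a :* (b :* d) := a :* (b :* (c :+ d))) refl _ _ _ _ ⟩
    y ^ b * (y ^ occ u * weight (v ∷ vs)) ∎

  glueWeight-product : ∀ b {us vs} → (∀ {u v} → u ∈ us → v ∈ vs → occ (glue (u , v)) ≡ b ℕ.+ (occ u ℕ.+ occ v)) →
    glueWeight (cartesianProduct us vs) ≈ y ^ b * (weight us * weight vs)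
  glueWeight-product b {[]}     {vs} _ = sym (trans (*-congˡ (zeroˡ _)) (zeroʳ _))
  glueWeight-product b {u ∷ us} {vs} h = begin
    glueWeight (map (u ,_) vs ++ cartesianProduct us vs)
      ≈⟨ glueWeight-++ (map (u ,_) vs) _ ⟩
    glueWeight (map (u ,_) vs) + glueWeight (cartesianProduct us vs)
      ≈⟨ +-cong (glueWeight-row b u (h (here ≡.refl))) (glueWeight-product b (h ∘ there)) ⟩
    y ^ b * (y ^ occ u * weight vs) + y ^ b * (weight us * weight vs)
      ≈⟨ solve 4 (λ a b c d → a :* (b :* c) :+ a :* (d :* c) := a :* ((b :+ d) :* c)) refl _ _ _ _ ⟩
    y ^ b * (weight (u ∷ us) * weight vs) ∎

  W : ℕ → Carrier
  W n = weight (avoiders n)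

  W⁺ : ℕ → Carrier
  W⁺ zero    = 0#
  W⁺ (suc n) = W (suc n)

  W-zero : W 0 ≈ 1#
  W-zero = +-identityʳ 1#

  glueWeight-avoiders : ∀ k l →
    glueWeight (cartesianProduct (avoiders k) (avoiders l)) ≈ y ^ bothPositive k l * (W k * W l)
  glueWeight-avoiders k l = glueWeight-product (bothPositive k l) {avoiders k} {avoiders l} λ u∈ v∈ →
    occ-glue-size {k} {l} (∈-avoiders⁻ u∈) (∈-avoiders⁻ v∈)

  -- Here 𝟙 is the indicator of length 0, and W ≈ 𝟙 + W⁺.
  term : ∀ k l →
    y ^ bothPositive k l * (W k * W l) ≈ 𝟙 k * 𝟙 l + (𝟙 k * W⁺ l + 𝟙 l * W⁺ k) + y * (W⁺ k * W⁺ l)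
  term zero    zero    = trans (*-congˡ (*-cong W-zero W-zero)) 
    (solve 1 (λ y → con 1 :* (con 1 :* con 1)
        := con 1 :* con 1 :+ (con 1 :* con 0 :+ con 1 :* con 0) :+ y :* (con 0 :* con 0)) refl y)
  term zero    (suc l) = trans (*-congˡ (*-congʳ W-zero))
    (solve 2 (λ y w → con 1 :* (con 1 :* w)
        := con 1 :* con 0 :+ (con 1 :* w :+ con 0 :* con 0) :+ y :* (con 0 :* w)) refl y _)
  term (suc k) zero    = trans (*-congˡ (*-congˡ W-zero))
    (solve 2 (λ y w → con 1 :* (w :* con 1)
        := con 0 :* con 1 :+ (con 0 :* con 0 :+ con 1 :* w) :+ y :* (w :* con 0)) refl y _)
  term (suc k) (suc l) =
    solve 3 (λ y v w → (y :* con 1) :* (v :* w)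
        := con 0 :* con 0 :+ (con 0 :* w :+ con 0 :* v) :+ y :* (v :* w)) refl y _ _

  -- `term` is summed over all lengths k + l = n. Convolution with `𝟙` is trivial, and only the
  -- product of the two nonempty parts keeps the factor `y`.
  W-suc : ∀ n → W (suc n) ≈ 𝟙 n + (W⁺ n + W⁺ n) + y * (W⁺ ⊛ W⁺) n
  W-suc n = begin
    W (suc n)                       ≈⟨ weight-↭ (avoiders-suc n) ⟩
    glueWeight (splits n)           ≈⟨ glueWeight-concat (splitsAt n) ⟩
    sum (glueWeight ∘ splitsAt n)
      ≈⟨ sum-cong-≋ {suc n} (λ i → trans (glueWeight-avoiders (toℕ i) (n ∸ toℕ i)) (term (toℕ i) (n ∸ toℕ i))) ⟩
    sum {suc n} (λ i → p i + (q i + r i) + y * s i)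
      ≈⟨ ∑-distrib-+ {suc n} (λ i → p i + (q i + r i)) (λ i → y * s i) ⟩
    sum {suc n} (λ i → p i + (q i + r i)) + sum {suc n} (λ i → y * s i)
      ≈⟨ +-cong (trans (∑-distrib-+ {suc n} p (λ i → q i + r i)) (+-congˡ (∑-distrib-+ {suc n} q r)))
           (sym (*-distribˡ-sum {suc n} y s)) ⟩
    (𝟙 ⊛ 𝟙) n + ((𝟙 ⊛ W⁺) n + sum {suc n} r) + y * (W⁺ ⊛ W⁺) n
      ≈⟨ +-congʳ (+-cong (⊛-identityˡ 𝟙 n) (+-cong (⊛-identityˡ W⁺ n)
           (trans (sum-cong-≋ {suc n} λ i → *-comm (𝟙 (n ∸ toℕ i)) (W⁺ (toℕ i)))
             (trans (⊛-comm W⁺ 𝟙 n) (⊛-identityˡ W⁺ n))))) ⟩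
    𝟙 n + (W⁺ n + W⁺ n) + y * (W⁺ ⊛ W⁺) n ∎
    where
    p q r s : Fin (suc n) → Carrier
    p i = 𝟙 (toℕ i) * 𝟙 (n ∸ toℕ i)
    q i = 𝟙 (toℕ i) * W⁺ (n ∸ toℕ i)
    r i = 𝟙 (n ∸ toℕ i) * W⁺ (toℕ i)
    s i = W⁺ (toℕ i) * W⁺ (n ∸ toℕ i)

open ≡ using (refl; sym; trans; cong; cong₂; module ≡-Reasoning)

ℚring : CommutativeRing _ _
ℚring = ℚ.+-*-commutativeRing

open PowerSeries ℚring using (Series; _≋_; x′; 𝟙; const; _⊛_; x-⊛-zero; x-⊛-suc; const-⊛)
  renaming (powerSeriesRing to X)

fromℚᵘ-homo-+ : ∀ p q → fromℚᵘ (p ℚᵘ.+ q) ≡ fromℚᵘ p ℚ.+ fromℚᵘ q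
fromℚᵘ-homo-+ p q = ℚ.toℚᵘ-injective (ℚᵘ.≃-trans (ℚ.toℚᵘ-fromℚᵘ (p ℚᵘ.+ q))
  (ℚᵘ.≃-sym (ℚᵘ.≃-trans (ℚ.toℚᵘ-homo-+ (fromℚᵘ p) (fromℚᵘ q)) (ℚᵘ.+-cong (ℚ.toℚᵘ-fromℚᵘ p) (ℚ.toℚᵘ-fromℚᵘ q)))))

fromℚᵘ-homo-* : ∀ p q → fromℚᵘ (p ℚᵘ.* q) ≡ fromℚᵘ p ℚ.* fromℚᵘ q
fromℚᵘ-homo-* p q = ℚ.toℚᵘ-injective (ℚᵘ.≃-trans (ℚ.toℚᵘ-fromℚᵘ (p ℚᵘ.* q))
  (ℚᵘ.≃-sym (ℚᵘ.≃-trans (ℚ.toℚᵘ-homo-* (fromℚᵘ p) (fromℚᵘ q)) (ℚᵘ.*-cong (ℚ.toℚᵘ-fromℚᵘ p) (ℚ.toℚᵘ-fromℚᵘ q)))))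

fromℕ-+ : ∀ m n → fromℕ (m ℕ.+ n) ≡ fromℕ m ℚ.+ fromℕ n
fromℕ-+ m n = trans (ℚ.fromℚᵘ-cong {mkℚᵘ (+ (m ℕ.+ n)) 0} {mkℚᵘ (+ m) 0 ℚᵘ.+ mkℚᵘ (+ n) 0}
    (*≡* (cong (ℤ._* + 1) (sym (cong₂ ℤ._+_ (ℤ.*-identityʳ (+ m)) (ℤ.*-identityʳ (+ n)))))))
  (fromℚᵘ-homo-+ (mkℚᵘ (+ m) 0) (mkℚᵘ (+ n) 0))

fromℕ-* : ∀ m n → fromℕ (m ℕ.* n) ≡ fromℕ m ℚ.* fromℕ n
fromℕ-* m n = trans (ℚ.fromℚᵘ-cong {mkℚᵘ (+ (m ℕ.* n)) 0} {mkℚᵘ (+ m) 0 ℚᵘ.* mkℚᵘ (+ n) 0}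
    (*≡* (cong (ℤ._* + 1) (ℤ.pos-* m n))))
  (fromℚᵘ-homo-* (mkℚᵘ (+ m) 0) (mkℚᵘ (+ n) 0))

1/[1+_] : ℕ → ℚ
1/[1+ n ] = + 1 ℚ./ suc n

1/-inverse : ∀ n → 1/[1+ n ] ℚ.* fromℕ (suc n) ≡ 1ℚ
1/-inverse n = trans (sym (fromℚᵘ-homo-* (mkℚᵘ (+ 1) n) (mkℚᵘ (+ suc n) 0)))
  (ℚ.fromℚᵘ-cong {mkℚᵘ (+ 1) n ℚᵘ.* mkℚᵘ (+ suc n) 0} {mkℚᵘ (+ 1) 0} (*≡* (cong +_ (lemma n))))
  where
  lemma : ∀ n → (suc n ℕ.+ 0) ℕ.* 1 ≡ suc n ℕ.* 1 ℕ.+ 0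
  lemma = solve-∀

fromℕ-cancel : ∀ n {p q} → fromℕ (suc n) ℚ.* p ≡ fromℕ (suc n) ℚ.* q → p ≡ q
fromℕ-cancel n {p} {q} eq = trans (sym (absorb p)) (trans (cong (1/[1+ n ] ℚ.*_) eq) (absorb q))
  where
  absorb : ∀ p → 1/[1+ n ] ℚ.* (fromℕ (suc n) ℚ.* p) ≡ p
  absorb p = trans (sym (ℚ.*-assoc 1/[1+ n ] (fromℕ (suc n)) p))
    (trans (cong (ℚ._* p) (1/-inverse n)) (ℚ.*-identityˡ p))

-- Central binomial coefficients and Catalan numbers

centralBinomial : ℕ → ℕ
centralBinomial r = (2 ℕ.* r) C r

centralBinomial-factorial : ∀ r → centralBinomial r ℕ.* (r ! ℕ.* r !) ≡ (2 ℕ.* r) !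
centralBinomial-factorial r = trans (cong (λ s → centralBinomial r ℕ.* (r ! ℕ.* s !)) (sym 2r∸r≡r))
  (trans (cong (ℕ._* (r ! ℕ.* (2 ℕ.* r ∸ r) !)) (nCk≡n!/k![n-k]! r≤2r))
    (m/n*n≡m {{r ℕ.!* (2 ℕ.* r ∸ r) !≢0}} (k![n∸k]!∣n! r≤2r)))
  where
  r≤2r : r ℕ.≤ 2 ℕ.* r
  r≤2r = ℕ.m≤m+n r _
  2r∸r≡r : 2 ℕ.* r ∸ r ≡ r
  2r∸r≡r = trans (ℕ.m+n∸m≡n r (r ℕ.+ 0)) (ℕ.+-identityʳ r)

-- After multiplication by (r + 1) r!² both sides equal (2r + 2)!, because (2r + 2)(2r + 1) = (4r +
-- 2)(r + 1).
centralBinomial-suc : ∀ r → suc r ℕ.* centralBinomial (suc r) ≡ (4 ℕ.* r ℕ.+ 2) ℕ.* centralBinomial r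
centralBinomial-suc r = ℕ.*-cancelʳ-≡ _ _ (suc r ℕ.* (r ! ℕ.* r !))
  {{ℕ.m*n≢0 (suc r) (r ! ℕ.* r !) {{_}} {{r ℕ.!* r !≢0}}}} (begin
  suc r ℕ.* centralBinomial (suc r) ℕ.* (suc r ℕ.* (r ! ℕ.* r !))
    ≡⟨ lemma₁ r (centralBinomial (suc r)) (r !) ⟩
  centralBinomial (suc r) ℕ.* (suc r ! ℕ.* suc r !)
    ≡⟨ centralBinomial-factorial (suc r) ⟩
  (2 ℕ.* suc r) !
    ≡⟨ cong _! (double r) ⟩
  suc (suc (2 ℕ.* r)) ℕ.* (suc (2 ℕ.* r) ℕ.* (2 ℕ.* r) !)
    ≡⟨ cong (λ b → suc (suc (2 ℕ.* r)) ℕ.* (suc (2 ℕ.* r) ℕ.* b)) (centralBinomial-factorial r) ⟨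
  suc (suc (2 ℕ.* r)) ℕ.* (suc (2 ℕ.* r) ℕ.* (centralBinomial r ℕ.* (r ! ℕ.* r !)))
    ≡⟨ lemma₂ r (centralBinomial r) (r !) ⟩
  (4 ℕ.* r ℕ.+ 2) ℕ.* centralBinomial r ℕ.* (suc r ℕ.* (r ! ℕ.* r !)) ∎)
  where
  open ≡-Reasoning
  lemma₁ : ∀ r b f → suc r ℕ.* b ℕ.* (suc r ℕ.* (f ℕ.* f)) ≡ b ℕ.* ((suc r ℕ.* f) ℕ.* (suc r ℕ.* f))
  lemma₁ = solve-∀
  lemma₂ : ∀ r b f → suc (suc (2 ℕ.* r)) ℕ.* (suc (2 ℕ.* r) ℕ.* (b ℕ.* (f ℕ.* f))) ≡
    (4 ℕ.* r ℕ.+ 2) ℕ.* b ℕ.* (suc r ℕ.* (f ℕ.* f))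
  lemma₂ = solve-∀
  double : ∀ r → 2 ℕ.* suc r ≡ suc (suc (2 ℕ.* r))
  double = solve-∀

catalan : ℕ → ℚ
catalan r = 1/[1+ r ] ℚ.* fromℕ (centralBinomial r)

fromℕ*catalan : ∀ r → fromℕ (suc r) ℚ.* catalan r ≡ fromℕ (centralBinomial r)
fromℕ*catalan r = trans (sym (ℚ.*-assoc (fromℕ (suc r)) 1/[1+ r ] _))
  (trans (cong (ℚ._* fromℕ (centralBinomial r)) (trans (ℚ.*-comm (fromℕ (suc r)) 1/[1+ r ]) (1/-inverse r)))
    (ℚ.*-identityˡ _))

catalan-suc : ∀ n → fromℕ (2 ℕ.+ n) ℚ.* catalan (suc n) ≡ (fromℕ 4 ℚ.* fromℕ n ℚ.+ fromℕ 2) ℚ.* catalan n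
catalan-suc n = fromℕ-cancel n (begin
  fromℕ (suc n) ℚ.* (fromℕ (2 ℕ.+ n) ℚ.* catalan (suc n)) ≡⟨ cong (fromℕ (suc n) ℚ.*_) (fromℕ*catalan (suc n)) ⟩
  fromℕ (suc n) ℚ.* fromℕ (centralBinomial (suc n))       ≡⟨ fromℕ-* (suc n) (centralBinomial (suc n)) ⟨
  fromℕ (suc n ℕ.* centralBinomial (suc n))               ≡⟨ cong fromℕ (centralBinomial-suc n) ⟩
  fromℕ ((4 ℕ.* n ℕ.+ 2) ℕ.* centralBinomial n)           ≡⟨ fromℕ-* (4 ℕ.* n ℕ.+ 2) (centralBinomial n) ⟩
  fromℕ (4 ℕ.* n ℕ.+ 2) ℚ.* fromℕ (centralBinomial n)     ≡⟨ cong₂ ℚ._*_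
      (trans (fromℕ-+ (4 ℕ.* n) 2) (cong (ℚ._+ fromℕ 2) (fromℕ-* 4 n)))
        (sym (fromℕ*catalan n)) ⟩
  k ℚ.* (fromℕ (suc n) ℚ.* catalan n)                     ≡⟨ ℚ.*-assoc k (fromℕ (suc n)) (catalan n) ⟨
  k ℚ.* fromℕ (suc n) ℚ.* catalan n                       ≡⟨ cong (ℚ._* catalan n) (ℚ.*-comm k (fromℕ (suc n))) ⟩
  fromℕ (suc n) ℚ.* k ℚ.* catalan n                       ≡⟨ ℚ.*-assoc (fromℕ (suc n)) k (catalan n) ⟩
  fromℕ (suc n) ℚ.* (k ℚ.* catalan n)                     ∎)
  where
  open ≡-Reasoning
  k = fromℕ 4 ℚ.* fromℕ n ℚ.+ fromℕ 2

catalan-convolution : ∀ n → catalan (suc n) ≡ (catalan ⊛ catalan) n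
catalan-convolution = CatalanConvolution.catalan-convolution ℚring
  fromℕ refl (fromℕ-+ 1) fromℕ-cancel catalan refl catalan-suc

-- The coefficients of xᵏ / (1 − 2x)ᵏ⁺¹; for n < k the truncated n ∸ k is harmless, as n C k ≡ 0.
scaledBinomial : ℕ → ℕ → ℕ
scaledBinomial k n = 2 ℕ.^ (n ∸ k) ℕ.* (n C k)

scaledBinomial-zero : ∀ k → scaledBinomial (suc k) 0 ≡ 0
scaledBinomial-zero k = ℕ.*-zeroʳ 1

scaledBinomial-0-suc : ∀ n → scaledBinomial 0 (suc n) ≡ 2 ℕ.* scaledBinomial 0 n
scaledBinomial-0-suc n = ℕ.*-assoc 2 (2 ℕ.^ n) 1

-- Pascal's rule with powers of 2, in the form that makes 1 - 2x times one series equal to x times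
-- the preceding one.
scaledBinomial-suc : ∀ k n → scaledBinomial (suc k) (suc n) ≡ scaledBinomial k n ℕ.+ 2 ℕ.* scaledBinomial (suc k) n
scaledBinomial-suc k n = begin
  2 ℕ.^ (n ∸ k) ℕ.* (suc n C suc k)                          ≡⟨ cong (2 ℕ.^ (n ∸ k) ℕ.*_) (nCk+nC[k+1]≡[n+1]C[k+1] n k) ⟨
  2 ℕ.^ (n ∸ k) ℕ.* (n C k ℕ.+ n C suc k)                    ≡⟨ ℕ.*-distribˡ-+ (2 ℕ.^ (n ∸ k)) (n C k) (n C suc k) ⟩
  scaledBinomial k n ℕ.+ 2 ℕ.^ (n ∸ k) ℕ.* (n C suc k)       ≡⟨ cong (scaledBinomial k n ℕ.+_) double ⟩
  scaledBinomial k n ℕ.+ 2 ℕ.* scaledBinomial (suc k) n      ∎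
  where
  open ≡-Reasoning
  double : 2 ℕ.^ (n ∸ k) ℕ.* (n C suc k) ≡ 2 ℕ.* scaledBinomial (suc k) n
  double with k ℕ.<? n
  ... | yes k<n = trans (cong (λ e → 2 ℕ.^ e ℕ.* (n C suc k)) (ℕ.+-∸-assoc 1 k<n))
    (ℕ.*-assoc 2 (2 ℕ.^ (n ∸ suc k)) (n C suc k))
  -- For n ≤ k the truncated exponents no longer differ by one, but the binomial coefficient makes
  -- both sides 0.
  ... | no k≮n  rewrite k>n⇒nCk≡0 {n} {suc k} (ℕ.≰⇒> k≮n) =
    trans (ℕ.*-zeroʳ (2 ℕ.^ (n ∸ k))) (cong (2 ℕ.*_) (sym (ℕ.*-zeroʳ (2 ℕ.^ (n ∸ suc k)))))

-- The generating function

module XS = PowerSeries X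
open XS using () renaming (powerSeriesRing to XY)
module X = CommutativeRing X
module XY = CommutativeRing XY

-- Here the variable of `X` stands for y, so that `W n r` counts avoiders of length n with r
-- occurrences.
open Weights X x′ using (weight; W; W⁺; W-suc)
module Uni = RingNotation X.rawRing
module Bi = RingNotation XY.rawRing
module UniLemmas = RingLemmas X
module BiLemmas = RingLemmas XY

monomial : ∀ k r → (x′ Uni.^ k) r ≡ fromℕ (indicator (k ℕ.≟ r))
monomial zero    zero    = refl
monomial zero    (suc r) = refl
monomial (suc k) zero    = x-⊛-zero (x′ Uni.^ k)
monomial (suc k) (suc r) = trans (x-⊛-suc (x′ Uni.^ k) r) (trans (monomial k r)
  (cong fromℕ (indicator-cong (k ℕ.≟ r) (suc k ℕ.≟ suc r) (cong suc) ℕ.suc-injective)))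

-- Whether a word has r occurrences is the coefficient of yʳ in its weight.
count-weight : ∀ r {n} (πs : List (Word n)) →
  fromℕ (length (filter (λ π → occ231 π ℕ.≟ r) πs)) ≡ weight (map toWord πs) r
count-weight r []       = refl
count-weight r (π ∷ πs) = begin
  fromℕ (count Q? (π ∷ πs))                               ≡⟨ cong fromℕ (count-∷ Q? π πs) ⟩
  fromℕ (indicator (Q? π) +ℕ count Q? πs)                 ≡⟨ fromℕ-+ (indicator (Q? π)) (count Q? πs) ⟩
  fromℕ (indicator (Q? π)) +ℚ fromℕ (count Q? πs)         ≡⟨ cong₂ _+ℚ_ (sym (monomial (occ231 π) r)) (count-weight r πs) ⟩
  (x′ Uni.^ occ231 π) r +ℚ weight (map toWord πs) r
    ≡⟨ cong (λ k → (x′ Uni.^ k) r +ℚ weight (map toWord πs) r) (count-occursAt π (occurs231At? π)) ⟩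
  weight (map toWord (π ∷ πs)) r ∎
  where
  open ≡-Reasoning
  Q? = λ π → occ231 π ℕ.≟ r

f231-W : ∀ r n → fromℕ (f231 r n) ≡ W n r
f231-W r n = count-weight r (avoidingPermutations n)

G : ℕ → Series
G r zero    = 0ℚ
G r (suc n) = fromℕ (f231 r (suc n))

G-W⁺ : ∀ r n → G r n ≡ W⁺ n r
G-W⁺ r zero    = refl
G-W⁺ r (suc n) = f231-W r (suc n)

F231-G : F231 XY.≈ XY.1# XY.+ G
-- For length 0 the counts compute: the empty permutation has no occurrence and accounts for the 1.
F231-G zero    zero    = refl
F231-G (suc r) zero    = refl
F231-G zero    (suc n) = sym (ℚ.+-identityˡ _)
F231-G (suc r) (suc n) = sym (ℚ.+-identityˡ _)

module ℚ-Sum = Algebra.Properties.Semiring.Sum (CommutativeRing.semiring ℚring)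
module X-Sum = Algebra.Properties.Semiring.Sum X.semiring

sum-coefficient : ∀ {k} (f : Fin k → Series) n → X-Sum.sum f n ≡ ℚ-Sum.sum (λ i → f i n)
sum-coefficient {zero}  f n = refl
sum-coefficient {suc k} f n = cong (f Fin.zero n +ℚ_) (sum-coefficient (λ i → f (Fin.suc i)) n)

-- The words are counted in ℚ[[y]][[x]], whereas F231 lives in ℚ[[x]][[y]].
transpose-⊛ : ∀ {f g : ℕ → Series} → (∀ r n → f r n ≡ g n r) → ∀ r n → (f XY.* f) r n ≡ (g XY.* g) n r
transpose-⊛ {f} {g} f≡gᵀ r n = begin
  (f XY.* f) r n
    ≡⟨ sum-coefficient {suc r} (λ i → f (toℕ i) X.* f (r ∸ toℕ i)) n ⟩
  ℚ-Sum.sum {suc r} (λ i → ℚ-Sum.sum {suc n} λ j → f (toℕ i) (toℕ j) *ℚ f (r ∸ toℕ i) (n ∸ toℕ j))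
    ≡⟨ ℚ-Sum.∑-comm {suc r} {suc n} (λ i j → f (toℕ i) (toℕ j) *ℚ f (r ∸ toℕ i) (n ∸ toℕ j)) ⟩
  ℚ-Sum.sum {suc n} (λ j → ℚ-Sum.sum {suc r} λ i → f (toℕ i) (toℕ j) *ℚ f (r ∸ toℕ i) (n ∸ toℕ j))
    ≡⟨ ℚ-Sum.sum-cong-≋ {suc n} (λ j → ℚ-Sum.sum-cong-≋ {suc r} λ i →
         cong₂ _*ℚ_ (f≡gᵀ (toℕ i) (toℕ j)) (f≡gᵀ (r ∸ toℕ i) (n ∸ toℕ j))) ⟩
  ℚ-Sum.sum {suc n} (λ j → ℚ-Sum.sum {suc r} λ i → g (toℕ j) (toℕ i) *ℚ g (n ∸ toℕ j) (r ∸ toℕ i))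
    ≡⟨ sum-coefficient {suc n} (λ j → g (toℕ j) X.* g (n ∸ toℕ j)) r ⟨
  (g XY.* g) n r ∎
  where open ≡-Reasoning

𝟙-transpose : ∀ r n → XY.1# r n ≡ XY.1# n r
𝟙-transpose zero    zero    = refl
𝟙-transpose zero    (suc n) = refl
𝟙-transpose (suc r) zero    = refl
𝟙-transpose (suc r) (suc n) = refl

G-equation : G XY.≈ Bivariate.x XY.* (XY.1# XY.+ (G XY.+ G) XY.+ Bivariate.y XY.* (G XY.* G))
-- `Bivariate.x` is constant in y, so it acts on each row separately as multiplication by `x′`.
G-equation r n = trans (coefficient r n) (sym (XS.const-⊛ x′ Z r n))
  where
  Z = XY.1# XY.+ (G XY.+ G) XY.+ Bivariate.y XY.* (G XY.* G)
  y-transpose : ∀ r n → (x′ ⊛ (W⁺ XY.* W⁺) n) r ≡ (Bivariate.y XY.* (G XY.* G)) r n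
  y-transpose zero    n = trans (x-⊛-zero ((W⁺ XY.* W⁺) n)) (sym (XS.x-⊛-zero (G XY.* G) n))
  y-transpose (suc r) n = trans (x-⊛-suc ((W⁺ XY.* W⁺) n) r)
    (trans (sym (transpose-⊛ G-W⁺ r n)) (sym (XS.x-⊛-suc (G XY.* G) r n)))
  coefficient : ∀ r n → G r n ≡ (x′ ⊛ Z r) n
  coefficient r zero    = sym (x-⊛-zero (Z r))
  coefficient r (suc n) = begin
    G r (suc n)   ≡⟨ f231-W r (suc n) ⟩
    W (suc n) r   ≡⟨ W-suc n r ⟩
    XY.1# n r +ℚ (W⁺ n r +ℚ W⁺ n r) +ℚ (x′ ⊛ (W⁺ XY.* W⁺) n) r
      ≡⟨ cong₂ _+ℚ_ (cong₂ _+ℚ_ (𝟙-transpose n r) (cong₂ _+ℚ_ (sym (G-W⁺ r n)) (sym (G-W⁺ r n))))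
           (y-transpose r n) ⟩
    Z r n         ≡⟨ x-⊛-suc (Z r) n ⟨
    (x′ ⊛ Z r) (suc n) ∎
    where open ≡-Reasoning

generatingFunction : let open Bivariate in
    ∃[ S ] (S ≈√ (1# - 4 · x + 4 · x ^ 2 - 4 · (x ^ 2 * y))
    × F231 ≈ (1# - 2 · x + 2 · (x * y) - S) ÷ (2 · (x * y)))
generatingFunction = S
  , ( BiLemmas.root-square {x = Bivariate.x} {y = Bivariate.y} {G = G} {S = S} XY.refl G-equation
    , S-constant )
  , XY.trans {F231 XY.* T} {(XY.1# XY.+ G) XY.* T} (XY.*-congʳ {T} {F231} {XY.1# XY.+ G} F231-G)
      (BiLemmas.root⇒quotient {x = Bivariate.x} {y = Bivariate.y} {G = G} {S = S} XY.refl)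
  where
  T = 2 Bi.· (Bivariate.x XY.* Bivariate.y)
  Z = 2 Bi.· (XY.1# XY.+ Bivariate.y XY.* G)
  S = XY.1# XY.- Bivariate.x XY.* Z
  -- `S` differs from 1 by a multiple of x.
  S-constant : ∀ r → S r 0 ≡ XY.1# r 0
  S-constant r = trans (cong (λ q → XY.1# r 0 ℚ.- q) (trans (XS.const-⊛ x′ Z r 0) (x-⊛-zero (Z r)))) (ℚ.+-identityʳ _)

-- The coefficients of yʳ as rational functions of x

u : Series
u = X.1# X.- 2 Uni.· x′

open import Algebra.Properties.Semiring.Exp X.semiring using (^-congʳ)
open import Algebra.Solver.Ring.NaturalCoefficients.Default X.commutativeSemiring using (solve; con; _:+_; _:*_; _:=_)

-- The common shape of the recursions for the rows of `G` and for the scaled binomials: the doubled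
-- term under x moves to the left as the factor 1 - 2x.
u-rule : ∀ {f g} → f ≋ g X.+ x′ X.* (f X.+ f) → f X.* u ≋ g
u-rule {f} {g} eq = UniLemmas.*-1-minus {f} {2 Uni.· x′} {g} (X.trans {f} {g X.+ x′ X.* (f X.+ f)} eq
  (solve 3 (λ x f g → g :+ x :* (f :+ f) := g :+ (x :+ (x :+ con 0)) :* f) X.refl x′ f g))

const-cong : ∀ {p q} → p ≡ q → const p ≋ const q
const-cong refl n = refl

const-* : ∀ p q → const (p *ℚ q) ≋ const p X.* const q
const-* p q n = trans (lemma n) (sym (const-⊛ p (const q) n))
  where
  lemma : ∀ n → const (p *ℚ q) n ≡ p *ℚ const q n
  lemma zero    = refl
  lemma (suc n) = sym (ℚ.*-zeroʳ p)

const-+ : ∀ p q → const (p +ℚ q) ≋ const p X.+ const q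
const-+ p q zero    = refl
const-+ p q (suc n) = refl

const-sum : ∀ {k} (f : Fin k → ℚ) → const (ℚ-Sum.sum f) ≋ X-Sum.sum (λ i → const (f i))
const-sum {zero}  f zero    = refl
const-sum {zero}  f (suc n) = refl
const-sum {suc k} f n = trans (const-+ (f Fin.zero) (ℚ-Sum.sum (λ i → f (Fin.suc i))) n)
  (cong (const (f Fin.zero) n +ℚ_) (const-sum (λ i → f (Fin.suc i)) n))

-- Carries the Catalan convolution from ℚ to the ring that contains the rows of `G`, where
-- `convolution-recurrence` is applied.
const-⊛ₛ : ∀ f r → const ((f ⊛ f) r) ≋ ((λ i → const (f i)) XY.* (λ i → const (f i))) r
const-⊛ₛ f r = X.trans {const ((f ⊛ f) r)} {X-Sum.sum {suc r} (λ i → const (f (toℕ i) *ℚ f (r ∸ toℕ i)))}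
  (const-sum {suc r} (λ i → f (toℕ i) *ℚ f (r ∸ toℕ i)))
  (X-Sum.sum-cong-≋ {suc r} λ i → const-* (f (toℕ i)) (f (r ∸ toℕ i)))

G-row : ∀ r → G r ≋ x′ X.* (XY.1# r X.+ (G r X.+ G r) X.+ (Bivariate.y XY.* (G XY.* G)) r)
G-row r n = trans (G-equation r n) (XS.const-⊛ x′ (XY.1# XY.+ (G XY.+ G) XY.+ Bivariate.y XY.* (G XY.* G)) r n)

G-zero : G 0 X.* u ≋ x′
G-zero = u-rule (X.trans {G 0} (G-row 0) (X.trans
  (X.*-congˡ {x′} (X.+-congˡ {X.1# X.+ (G 0 X.+ G 0)} (XS.x-⊛-zero (G XY.* G))))
  (solve 2 (λ x g → x :* (con 1 :+ (g :+ g) :+ con 0) := x :+ x :* (g :+ g)) X.refl x′ (G 0))))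

G-suc : ∀ r → G (suc r) X.* u ≋ x′ X.* (G XY.* G) r
G-suc r = u-rule (X.trans {G (suc r)} (G-row (suc r)) (X.trans
  (X.*-congˡ {x′} (X.+-congˡ {X.0# X.+ (G (suc r) X.+ G (suc r))} (XS.x-⊛-suc (G XY.* G) r)))
  (solve 3 (λ x g h → x :* (con 0 :+ (g :+ g) :+ h) := x :* h :+ x :* (g :+ g)) X.refl x′ (G (suc r)) ((G XY.* G) r))))

G-closed : ∀ r → G r X.* u Uni.^ (2 *ℕ r +ℕ 1) ≋ const (catalan r) X.* x′ Uni.^ (2 *ℕ r +ℕ 1)
G-closed = UniLemmas.convolution-recurrence {u} {x′} G (λ r → const (catalan r)) G-zero const-1 G-suc
  (λ r n → trans (const-cong (catalan-convolution r) n) (const-⊛ₛ catalan r n))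
  where
  const-1 : const 1ℚ ≋ X.1#
  const-1 zero    = refl
  const-1 (suc _) = refl

-- Expansion of xᵏ / (1 - 2x)ᵏ⁺¹ and the explicit formula

H : ℕ → Series
H k n = fromℕ (scaledBinomial k n)

fromℕ-double : ∀ n → fromℕ (2 *ℕ n) ≡ fromℕ n +ℚ fromℕ n
fromℕ-double n = trans (cong (λ m → fromℕ (n +ℕ m)) (ℕ.+-identityʳ n)) (fromℕ-+ n n)

H-zero : H 0 X.* u ≋ X.1#
H-zero = u-rule eq
  where
  eq : H 0 ≋ X.1# X.+ x′ X.* (H 0 X.+ H 0)
  eq zero    = sym (trans (cong (1ℚ +ℚ_) (x-⊛-zero (H 0 X.+ H 0))) (ℚ.+-identityʳ 1ℚ))
  eq (suc n) = trans (trans (cong fromℕ (scaledBinomial-0-suc n)) (fromℕ-double (scaledBinomial 0 n)))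
    (sym (trans (cong (0ℚ +ℚ_) (x-⊛-suc (H 0 X.+ H 0) n)) (ℚ.+-identityˡ _)))

H-suc : ∀ k → H (suc k) X.* u ≋ x′ X.* H k
H-suc k = u-rule eq
  where
  eq : H (suc k) ≋ x′ X.* H k X.+ x′ X.* (H (suc k) X.+ H (suc k))
  eq zero    = trans (cong fromℕ (scaledBinomial-zero k))
    (sym (cong₂ _+ℚ_ (x-⊛-zero (H k)) (x-⊛-zero (H (suc k) X.+ H (suc k)))))
  eq (suc n) = trans (trans (cong fromℕ (scaledBinomial-suc k n))
      (trans (fromℕ-+ (scaledBinomial k n) _) (cong (H k n +ℚ_) (fromℕ-double (scaledBinomial (suc k) n)))))
    (sym (cong₂ _+ℚ_ (x-⊛-suc (H k) n) (x-⊛-suc (H (suc k) X.+ H (suc k)) n)))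

H-closed : ∀ k → H k X.* u Uni.^ suc k ≋ x′ Uni.^ k
H-closed zero    = X.trans {H 0 X.* (u X.* X.1#)} (X.*-congˡ {H 0} (X.*-identityʳ u)) H-zero
H-closed (suc k) = begin
  H (suc k) X.* (u X.* u Uni.^ suc k) ≈⟨ X.*-assoc (H (suc k)) u (u Uni.^ suc k) ⟨
  H (suc k) X.* u X.* u Uni.^ suc k   ≈⟨ X.*-congʳ {u Uni.^ suc k} (H-suc k) ⟩
  x′ X.* H k X.* u Uni.^ suc k        ≈⟨ X.*-assoc x′ (H k) (u Uni.^ suc k) ⟩
  x′ X.* (H k X.* u Uni.^ suc k)      ≈⟨ X.*-congˡ {x′} (H-closed k) ⟩
  x′ X.* x′ Uni.^ k                   ∎
  where open import Relation.Binary.Reasoning.Setoid X.setoid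

-- Both sides agree after multiplication by `u` to the power 2r + 1, which can be cancelled since
-- `H 0` inverts `u`.
G-H : ∀ r → G r ≋ const (catalan r) X.* (x′ X.* H (2 *ℕ r))
G-H r = UniLemmas.*-cancel-^ {u} {H 0} (X.trans {u X.* H 0} (X.*-comm u (H 0)) H-zero) (2 *ℕ r +ℕ 1) (begin
  G r X.* u Uni.^ (2 *ℕ r +ℕ 1)  ≈⟨ G-closed r ⟩
  const (catalan r) X.* x′ Uni.^ (2 *ℕ r +ℕ 1)
    ≈⟨ X.*-congˡ {const (catalan r)} (^-congʳ x′ 2r+1) ⟩
  const (catalan r) X.* (x′ X.* x′ Uni.^ (2 *ℕ r))
    ≈⟨ X.*-congˡ {const (catalan r)} (X.*-congˡ {x′} (H-closed (2 *ℕ r))) ⟨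
  const (catalan r) X.* (x′ X.* (H (2 *ℕ r) X.* u Uni.^ suc (2 *ℕ r)))
    ≈⟨ X.*-congˡ {const (catalan r)} (X.*-congˡ {x′} (X.*-congˡ {H (2 *ℕ r)} (^-congʳ u 2r+1))) ⟨
  const (catalan r) X.* (x′ X.* (H (2 *ℕ r) X.* u Uni.^ (2 *ℕ r +ℕ 1)))
    ≈⟨ solve 4 (λ a b c d → a :* (b :* (c :* d)) := a :* (b :* c) :* d) X.refl
         (const (catalan r)) x′ (H (2 *ℕ r)) (u Uni.^ (2 *ℕ r +ℕ 1)) ⟩
  const (catalan r) X.* (x′ X.* H (2 *ℕ r)) X.* u Uni.^ (2 *ℕ r +ℕ 1) ∎)
  where
  open import Relation.Binary.Reasoning.Setoid X.setoid
  2r+1 : 2 *ℕ r +ℕ 1 ≡ suc (2 *ℕ r)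
  2r+1 = ℕ.+-comm (2 *ℕ r) 1

f231-closed : ∀ r m → fromℕ (f231 r (suc m)) ≡ catalan r *ℚ fromℕ (scaledBinomial (2 *ℕ r) m)
f231-closed r m = trans (G-H r (suc m)) (trans (const-⊛ (catalan r) (x′ X.* H (2 *ℕ r)) (suc m))
  (cong (catalan r *ℚ_) (x-⊛-suc (H (2 *ℕ r)) m)))

exponent : ∀ {k m} → k ℕ.≤ m → + suc m -ℤ + k -ℤ + 1 ≡ + (m ∸ k)
exponent {k} {m} k≤m = trans (cong (_-ℤ + 1) (trans (ℤ.m-n≡m⊖n (suc m) k)
  (trans (ℤ.⊖-≥ (ℕ.m≤n⇒m≤1+n k≤m)) (cong +_ (ℕ.+-∸-assoc 1 k≤m)))))
  (ℤ.m-n≡m⊖n (suc (m ∸ k)) 1)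

-- The integer exponent agrees with the truncated one for k ≤ m. It is negative only when `m C k`
-- vanishes, where the value of the power does not matter.
scaledBinomial-2^ : ∀ k m → fromℕ (scaledBinomial k m) ≡ (2^ (+ suc m -ℤ + k -ℤ + 1)) *ℚ fromℕ (m C k)
scaledBinomial-2^ k m with k ℕ.≤? m
... | yes k≤m rewrite exponent k≤m = fromℕ-* (2 ℕ.^ (m ∸ k)) (m C k)
... | no  k≰m rewrite k>n⇒nCk≡0 (ℕ.≰⇒> k≰m) = trans (cong fromℕ (ℕ.*-zeroʳ (2 ℕ.^ (m ∸ k))))
  (sym (ℚ.*-zeroʳ (2^ (+ suc m -ℤ + k -ℤ + 1))))

-- At r = n = 0 the formula would give 0, because binom(-1, 0) is 0 by convention, whereas the empty
-- permutation is counted. For n = 0 < r the same convention gives the correct value 0.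
explicitFormula : ∀ (r n : ℕ) → ¬ (r ≡ 0 × n ≡ 0) →
        fromℕ (f231 r n) ≡
          ((2^ (+ n -ℤ + (2 *ℕ r) -ℤ + 1)) *ℚ (+ 1 / suc r))
            *ℚ fromℕ (binom (+ n -ℤ + 1) (+ (2 *ℕ r)))
            *ℚ fromℕ (binom (+ (2 *ℕ r)) (+ r))
explicitFormula zero    zero    ≢0 = ⊥-elim (≢0 (refl , refl))
explicitFormula (suc r) zero    _  = sym
  (trans (cong (_*ℚ b) (ℚ.*-zeroʳ ((2^ (+ 0 -ℤ + (2 *ℕ suc r) -ℤ + 1)) *ℚ (+ 1 / suc (suc r))))) (ℚ.*-zeroˡ b))
  where b = fromℕ (binom (+ (2 *ℕ suc r)) (+ suc r))
explicitFormula r       (suc m) _  = trans (f231-closed r m)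
  (trans (cong (catalan r *ℚ_) (scaledBinomial-2^ (2 *ℕ r) m))
    (rearrange (+ 1 / suc r) (fromℕ (centralBinomial r)) (2^ (+ suc m -ℤ + (2 *ℕ r) -ℤ + 1))
      (fromℕ (m C (2 *ℕ r)))))
  where
  open import Algebra.Solver.Ring.NaturalCoefficients.Default (CommutativeRing.commutativeSemiring ℚring)
    using () renaming (solve to ℚ-solve; _:*_ to _⊗_; _:=_ to _⊜_)
  rearrange : ∀ a b c d → (a *ℚ b) *ℚ (c *ℚ d) ≡ ((c *ℚ a) *ℚ d) *ℚ b
  rearrange = ℚ-solve 4 (λ a b c d → (a ⊗ b) ⊗ (c ⊗ d) ⊜ ((c ⊗ a) ⊗ d) ⊗ b) refl

-- The empty permutation enters F only at r = 0, where it is subtracted; for r > 0 the rows of F and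
-- G coincide.
univariate : let open Univariate in
      (F231[ 0 ] - 1# ≈ x ÷ (1# - 2 · x))
      × (∀ (r : ℕ) → 0 < r →
          F231[ r ] ≈ scalar ((+ 1 / suc r) *ℚ fromℕ (binom (+ (2 *ℕ r)) (+ r))) * x ^ (2 *ℕ r +ℕ 1)
                    ÷ ((1# - 2 · x) ^ (2 *ℕ r +ℕ 1)))
univariate = X.trans {(F231[ 0 ] X.- X.1#) X.* u} (X.*-congʳ {u} F₀-1) G-zero , λ where
    (suc r) _ → X.trans {F231[ suc r ] X.* u Uni.^ (2 *ℕ suc r +ℕ 1)}
      (X.*-congʳ {u Uni.^ (2 *ℕ suc r +ℕ 1)} (Fᵣ r)) (G-closed (suc r))
  where
  open import Algebra.Properties.AbelianGroup X.+-abelianGroup using (xyx⁻¹≈y)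
  F₀-1 : F231[ 0 ] X.- X.1# ≋ G 0
  F₀-1 = X.trans {F231[ 0 ] X.- X.1#} (X.+-congʳ {X.- X.1#} (F231-G 0)) (xyx⁻¹≈y X.1# (G 0))
  Fᵣ : ∀ r → F231[ suc r ] ≋ G (suc r)
  Fᵣ r = X.trans {F231[ suc r ]} (F231-G (suc r)) (X.+-identityˡ (G (suc r)))

theorem3p2 : (let open Bivariate in
    ∃[ S ] (S ≈√ (1# - 4 · x + 4 · x ^ 2 - 4 · (x ^ 2 * y))
    × F231 ≈ (1# - 2 · x + 2 · (x * y) - S) ÷ (2 · (x * y))))
    × (let open Univariate in
    (F231[ 0 ] - 1# ≈ x ÷ (1# - 2 · x))
    × (∀ (r : ℕ) → 0 < r →
    F231[ r ] ≈ scalar ((+ 1 / suc r) *ℚ fromℕ (binom (+ (2 *ℕ r)) (+ r))) * x ^ (2 *ℕ r +ℕ 1)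
    ÷ ((1# - 2 · x) ^ (2 *ℕ r +ℕ 1))))
    × (f231 0 0 ≡ 1)
    × (∀ (r n : ℕ) → ¬ (r ≡ 0 × n ≡ 0) →
    fromℕ (f231 r n) ≡
    ((2^ (+ n -ℤ + (2 *ℕ r) -ℤ + 1)) *ℚ (+ 1 / suc r))
    *ℚ fromℕ (binom (+ n -ℤ + 1) (+ (2 *ℕ r)))
    *ℚ fromℕ (binom (+ (2 *ℕ r)) (+ r)))
theorem3p2 = generatingFunction , univariate , refl , explicitFormula
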